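{- Let $k\in\mathbb{Z}^+$ and let $n\geq 2k+1$. Then $$\frac1{n!}\sum_{\pi\in\mathcal{S}_n}\operatorname{inv}(\pi^k)=\frac{n(n-1)}4-\frac{(\tau(k)-1)n}6-\frac{\tau^2(k)-\tau(k)-\tau_{\mathrm{o}}(k)+\sigma(k)}{12}.$$
   Context: $\mathcal{S}_n$ is the symmetric group on $[n]=\{1,\dots,n\}$. For $\pi\in\mathcal{S}_n$, an inversion of $\pi$ is a pair of indices $i<j$ in $[n]$ with $\pi(i)>\pi(j)$, and $\operatorname{inv}(\pi)$ is the number of inversions. For $k\in\mathbb{Z}^+$, $\tau(k)$ is the number of positive divisors of $k$, $\sigma(k)$ is the sum of the positive divisors of $k$, $\nu_2(k)$ is the exponent of $2$ in the prime factorization of $k$, and $\tau_{\mathrm{o}}(k)=\tau(k/2^{\nu_2(k)})$ is the number of odd positive divisors of $k$. -}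

module Defs where

open import Data.Nat using (ℕ; zero; suc; _*_; _<_; _>_; _<?_; _>?_; NonZero)
open import Data.Nat.Properties using (_!≢0)
open import Data.Nat using (_!)
open import Data.Nat.Divisibility using (_∣?_)
open import Data.Fin using (Fin; toℕ)
open import Data.Fin.Properties using () renaming (_≟_ to _≟F_)
open import Data.Vec using (Vec; []; _∷_; lookup; toList)
open import Data.List using (List; []; _∷_; length; filter; map; upTo; allFin; concatMap; cartesianProduct)
open import Data.Nat.ListAction using (sum)
open import Data.Integer using (+_)
open import Data.Rational using (ℚ; _/_)
open import Data.Product using (_,_; _×_)
open import Relation.Nullary.Decidable using (_×-dec_; ¬?)
open import Data.List.Relation.Unary.AllPairs as AllPairs using (allPairs?)

divisors : ℕ → List ℕ
divisors k = filter (_∣? k) (map suc (upTo k))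

τ : ℕ → ℕ
τ k = length (divisors k)

σ : ℕ → ℕ
σ k = sum (divisors k)

τₒ : ℕ → ℕ
τₒ k = length (filter (λ d → ¬? (2 ∣? d)) (divisors k))

-- Permutations of Fin n in one-line notation: π ↦ (π(0), …, π(n-1))

allVecs : (m n : ℕ) → List (Vec (Fin n) m)
allVecs zero    n = [] ∷ []
allVecs (suc m) n = concatMap (λ x → map (x ∷_) (allVecs m n)) (allFin n)

-- S_n: the vectors of length n over Fin n with pairwise distinct entries
-- (i.e. injective, hence bijective, maps Fin n → Fin n); each permutation
-- occurs exactly once in this list.
perms : (n : ℕ) → List (Vec (Fin n) n)
perms n = filter (λ v → allPairs? (λ x y → ¬? (x ≟F y)) (toList v)) (allVecs n n)

app : ∀ {n} → Vec (Fin n) n → Fin n → Fin n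
app v i = lookup v i

iter : ∀ {A : Set} → ℕ → (A → A) → A → A
iter zero    f x = x
iter (suc k) f x = f (iter k f x)

invF : ∀ {n} → (Fin n → Fin n) → ℕ
invF {n} f = length (filter (λ p → (toℕ (Data.Product.proj₁ p) <? toℕ (Data.Product.proj₂ p))
                                   ×-dec (toℕ (f (Data.Product.proj₁ p)) >? toℕ (f (Data.Product.proj₂ p))))
                            (cartesianProduct (allFin n) (allFin n)))

sumInvPow : ℕ → ℕ → ℕ
sumInvPow n k = sum (map (λ v → invF (iter k (app v))) (perms n))

avgInvPow : ℕ → ℕ → ℚ
avgInvPow n k = (+ sumInvPow n k) / (n !)
  where instance _ = n !≢0

{-# OPTIONS --safe #-}
-- The average over π is invariant under conjugation, so inv(πᵏ) may be replaced by the mean of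
-- inv(g πᵏ g⁻¹) over all g. For f = πᵏ and points x, y, the probability that g x < g y and
-- g (f x) > g (f y) depends only on the coincidences among x, y, f x, f y. Summing over x and y
-- expresses the mean through the numbers of fixed points of f and of f², namely
-- (3n² + 2n + Fix f² − 2n Fix f − (Fix f)² − 3n) / 12.
-- The averages of Fix πᵏ, Fix π²ᵏ and (Fix πᵏ)² are τ(k), τ(2k) and τ(k)² + σ(k): a cycle of
-- length d with a marked point, or two disjoint such cycles, is an injective tuple t with
-- π t = ρ t for a fixed rearrangement ρ, and the number of such tuples is 1 on average.
-- Finally τ(2k) = τ(k) + τₒ(k).
module Submission where

open import Defs
open import Data.Bool using (if_then_else_; true; false)
open import Data.Nat hiding (_≟_; _/_)
open import Data.Nat.Properties hiding (_≟_)
open import Data.Nat.Coprimality using (Coprime; coprime-divisor)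
open import Data.Nat.Divisibility using (_∣_; _∣?_; divides; ∣⇒≤; ∣-refl; ∣-antisym; ∣m⇒∣m*n; n∣m*n; m%n≡0⇒n∣m; *-monoˡ-∣; *-cancelʳ-∣)
import Data.Nat.DivMod as ℕ
open import Data.Nat.DivMod using (m≡m%n+[m/n]*n; m%n<n; m*n/n≡m)
open import Data.Nat.Induction using (<-rec)
open import Data.Nat.ListAction using (sum)
open import Data.Nat.ListAction.Properties using (sum-++; sum-↭)
open import Data.Nat.Tactic.RingSolver using (solve-∀)
open import Data.Fin using (Fin; zero; suc; toℕ)
open import Data.Fin.Properties using (_≟_; any?; injective⇒≤; punchOut-injective; toℕ-injective)
open import Data.Fin.Permutation using (Permutation′; permutation; _⟨$⟩ʳ_; _⟨$⟩ˡ_; inverseˡ; inverseʳ; transpose; _∘ₚ_; flip) renaming (id to idₚ)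
open import Data.List using (List; []; _∷_; _++_; length; filter; map; concatMap; cartesianProduct; cartesianProductWith; allFin; upTo)
open import Data.List.Properties using (map-++; map-∘; map-id; length-tabulate)
open import Data.List.Membership.Propositional using (_∈_; _∉_)
open import Data.List.Membership.Propositional.Properties using (∈-map⁺; ∈-map⁻; ∈-filter⁺; ∈-filter⁻; ∈-allFin; ∈-upTo⁺; ∈-upTo⁻; ∈-cartesianProduct⁺; ∈-cartesianProductWith⁺)
open import Data.List.Membership.Propositional.Properties.WithK using (unique∧set⇒bag)
open import Data.List.Membership.DecPropositional using (_∈?_)
open import Data.List.Relation.Binary.BagAndSetEquality using (∼bag⇒↭)
open import Data.List.Relation.Binary.Disjoint.Propositional using (Disjoint)
open import Data.List.Relation.Binary.Permutation.Propositional using (_↭_; ↭-refl; ↭-trans; ↭-reflexive; ↭⇒↭ₛ)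
import Data.List.Relation.Binary.Permutation.Propositional.Properties as ↭
import Data.List.Relation.Binary.Permutation.Setoid.Properties as ↭ₛ
open import Data.List.Relation.Unary.All as All using ([]; _∷_)
import Data.List.Relation.Unary.All.Properties as All
open import Data.List.Relation.Unary.AllPairs using ([]; _∷_; allPairs?)
open import Data.List.Relation.Unary.Any using (here; there)
open import Data.List.Relation.Unary.Unique.Propositional using (Unique)
import Data.List.Relation.Unary.Unique.Propositional.Properties as Unique
open import Data.Vec as Vec using (Vec; []; _∷_; lookup; toList; tabulate)
import Data.Vec.Properties as Vec
import Data.Vec.Relation.Unary.All.Properties as VAll
import Data.Vec.Relation.Unary.AllPairs as VPairs
import Data.Vec.Relation.Unary.Unique.Propositional as VUnique
import Data.Vec.Relation.Unary.Unique.Propositional.Properties as VUnique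
open import Data.Product using (_×_; _,_; ∃; proj₁; proj₂)
open import Data.Unit using (tt)
open import Function using (_∘_; id; mk⇔; Injective)
open import Relation.Binary using (tri<; tri≈; tri>)
open import Relation.Binary.PropositionalEquality
open import Relation.Binary.PropositionalEquality.Properties using (setoid)
open import Relation.Nullary using (Dec; yes; no; does; ¬_; contradiction)
open import Relation.Nullary.Decidable using (_×-dec_; ¬?; dec-true; dec-false)

open ≡-Reasoning

-- All counts stay in `ℕ`: probabilities are multiplied by n!, and subtracted terms stand on the
-- opposite side of an equation, so rationals enter only at the very end. For x ≠ y with images a,
-- b, twelve times the probability of an inversion is 3 without coincidences, 4 if exactly one of a
-- = y, b = x holds, 6 if both hold, 2 if exactly one of the points is fixed and 0 if both are. For
-- x = y it is 0. Products of indicators interpolate these values, and 12 is the common denominator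
-- of 1/2, 1/3, 1/4 and 1/6. In (Fix πᵏ)² the term σ(k) comes from ordered pairs on a common cycle,
-- since a point of period d has d partners there. Pairs on different cycles contribute 1 on average
-- for each pair (d, e) of divisors, which gives τ(k)². Two disjoint cycles of lengths d, e ≤ k must
-- fit into n points, as must one cycle of length up to 2k for π²ᵏ; this is where `k + k ≤ n`
-- enters.

private variable
  A B P Q : Set
  m n : ℕ

-- Finite sums and indicators

⟦_⟧ : Dec P → ℕ
⟦ d ⟧ = if does d then 1 else 0

⟦⟧-yes : (d : Dec P) → P → ⟦ d ⟧ ≡ 1
⟦⟧-yes (yes _) p = refl
⟦⟧-yes (no ¬p) p = contradiction p ¬p

⟦⟧-no : (d : Dec P) → ¬ P → ⟦ d ⟧ ≡ 0
⟦⟧-no (yes p) ¬p = contradiction p ¬p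
⟦⟧-no (no _)  ¬p = refl

⟦⟧-cong : (d : Dec P) (e : Dec Q) → (P → Q) → (Q → P) → ⟦ d ⟧ ≡ ⟦ e ⟧
⟦⟧-cong (yes p) e f g = sym (⟦⟧-yes e (f p))
⟦⟧-cong (no ¬p) e f g = sym (⟦⟧-no e (¬p ∘ g))

⟦⟧-× : (d : Dec P) (e : Dec Q) → ⟦ d ×-dec e ⟧ ≡ ⟦ d ⟧ * ⟦ e ⟧
⟦⟧-× (yes _) (yes _) = refl
⟦⟧-× (yes _) (no _)  = refl
⟦⟧-× (no _)  e       = refl

⟦⟧-¬ : (d : Dec P) → ⟦ d ⟧ + ⟦ ¬? d ⟧ ≡ 1
⟦⟧-¬ (yes _) = refl
⟦⟧-¬ (no _)  = refl

⟦⟧*-cong : (d : Dec P) {m n : ℕ} → (P → m ≡ n) → ⟦ d ⟧ * m ≡ ⟦ d ⟧ * n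
⟦⟧*-cong (yes p) e = cong (1 *_) (e p)
⟦⟧*-cong (no _)  e = refl

∑ : List A → (A → ℕ) → ℕ
∑ xs f = sum (map f xs)

∑-cong : (xs : List A) {f g : A → ℕ} → (∀ {x} → x ∈ xs → f x ≡ g x) → ∑ xs f ≡ ∑ xs g
∑-cong []       eq = refl
∑-cong (x ∷ xs) eq = cong₂ _+_ (eq (here refl)) (∑-cong xs (eq ∘ there))

∑-ext : (xs : List A) {f g : A → ℕ} → (∀ x → f x ≡ g x) → ∑ xs f ≡ ∑ xs g
∑-ext xs eq = ∑-cong xs (λ {x} _ → eq x)

∑-+ : (xs : List A) (f g : A → ℕ) → ∑ xs (λ x → f x + g x) ≡ ∑ xs f + ∑ xs g
∑-+ []       f g = refl
∑-+ (x ∷ xs) f g = trans (cong (f x + g x +_) (∑-+ xs f g)) (interchange (f x) (g x) (∑ xs f) (∑ xs g))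
  where
  interchange : ∀ a b c d → a + b + (c + d) ≡ a + c + (b + d)
  interchange = solve-∀

∑-*ˡ : (xs : List A) (c : ℕ) (f : A → ℕ) → ∑ xs (λ x → c * f x) ≡ c * ∑ xs f
∑-*ˡ []       c f = sym (*-zeroʳ c)
∑-*ˡ (x ∷ xs) c f = trans (cong (c * f x +_) (∑-*ˡ xs c f)) (sym (*-distribˡ-+ c (f x) (∑ xs f)))

∑-*ʳ : (xs : List A) (c : ℕ) (f : A → ℕ) → ∑ xs (λ x → f x * c) ≡ ∑ xs f * c
∑-*ʳ xs c f = begin
  ∑ xs (λ x → f x * c)  ≡⟨ ∑-ext xs (λ x → *-comm (f x) c) ⟩
  ∑ xs (λ x → c * f x)  ≡⟨ ∑-*ˡ xs c f ⟩
  c * ∑ xs f            ≡⟨ *-comm c _ ⟩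
  ∑ xs f * c            ∎

∑-const : (xs : List A) (c : ℕ) → ∑ xs (λ _ → c) ≡ length xs * c
∑-const []       c = refl
∑-const (x ∷ xs) c = cong (c +_) (∑-const xs c)

∑-zero : (xs : List A) → ∑ xs (λ _ → 0) ≡ 0
∑-zero xs = trans (∑-const xs 0) (*-zeroʳ (length xs))

∑-swap : (xs : List A) (ys : List B) (f : A → B → ℕ) →
         ∑ xs (λ x → ∑ ys (f x)) ≡ ∑ ys (λ y → ∑ xs (λ x → f x y))
∑-swap []       ys f = sym (∑-zero ys)
∑-swap (x ∷ xs) ys f = trans (cong (∑ ys (f x) +_) (∑-swap xs ys f))
                             (sym (∑-+ ys (f x) (λ y → ∑ xs (λ x → f x y))))

∑-map : (φ : A → B) (xs : List A) (f : B → ℕ) → ∑ (map φ xs) f ≡ ∑ xs (f ∘ φ)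
∑-map φ xs f = cong sum (sym (map-∘ xs))

∑-++ : (xs ys : List A) (f : A → ℕ) → ∑ (xs ++ ys) f ≡ ∑ xs f + ∑ ys f
∑-++ xs ys f = trans (cong sum (map-++ f xs ys)) (sum-++ (map f xs) (map f ys))

∑-concatMap : (φ : A → List B) (xs : List A) (f : B → ℕ) → ∑ (concatMap φ xs) f ≡ ∑ xs (λ x → ∑ (φ x) f)
∑-concatMap φ []       f = refl
∑-concatMap φ (x ∷ xs) f = trans (∑-++ (φ x) (concatMap φ xs) f) (cong (∑ (φ x) f +_) (∑-concatMap φ xs f))

∑-cartesianProduct : (xs : List A) (ys : List B) (f : A × B → ℕ) →
                     ∑ (cartesianProduct xs ys) f ≡ ∑ xs (λ x → ∑ ys (λ y → f (x , y)))
∑-cartesianProduct []       ys f = refl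
∑-cartesianProduct (x ∷ xs) ys f =
  trans (∑-++ (map (x ,_) ys) _ f) (cong₂ _+_ (∑-map (x ,_) ys f) (∑-cartesianProduct xs ys f))

module _ {P : A → Set} (P? : (x : A) → Dec (P x)) where

  length-filter : (xs : List A) → length (filter P? xs) ≡ ∑ xs (λ x → ⟦ P? x ⟧)
  length-filter []       = refl
  length-filter (x ∷ xs) with does (P? x)
  ... | true  = cong suc (length-filter xs)
  ... | false = length-filter xs

length≡∑ : (xs : List A) → length xs ≡ ∑ xs (λ _ → 1)
length≡∑ xs = trans (sym (*-identityʳ _)) (sym (∑-const xs 1))

∑-single : {xs : List A} (f : A → ℕ) {x : A} → Unique xs → x ∈ xs →
           (∀ {y} → y ∈ xs → y ≢ x → f y ≡ 0) → ∑ xs f ≡ f x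
∑-single {xs = x ∷ xs} f (x∉ ∷ u) (here refl) f0 = begin
  f x + ∑ xs f           ≡⟨ cong (f x +_) (∑-cong xs (λ y∈ → f0 (there y∈) (All.lookup x∉ y∈ ∘ sym))) ⟩
  f x + ∑ xs (λ _ → 0)   ≡⟨ cong (f x +_) (∑-zero xs) ⟩
  f x + 0                ≡⟨ +-identityʳ (f x) ⟩
  f x                    ∎
∑-single {xs = z ∷ xs} f (z∉ ∷ u) (there x∈) f0 =
  cong₂ _+_ (f0 (here refl) (All.lookup z∉ x∈)) (∑-single f u x∈ (f0 ∘ there))

Unique-map : {φ : A → B} {xs : List A} → (∀ {x y} → x ∈ xs → y ∈ xs → φ x ≡ φ y → x ≡ y) →
             Unique xs → Unique (map φ xs)
Unique-map inj []       = []
Unique-map inj (x∉ ∷ u) =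
  All.map⁺ (All.tabulate (λ y∈ eq → All.lookup x∉ y∈ (inj (here refl) (there y∈) eq)))
  ∷ Unique-map (λ x∈ y∈ → inj (there x∈) (there y∈)) u

-- Duplicate-free lists with the same members are permutations of each other, so `map φ xs` and `ys`
-- have the same sum.
∑-bijection : {xs : List A} {ys : List B} {f : A → ℕ} {g : B → ℕ} →
              Unique xs → Unique ys → (φ : A → B) (ψ : B → A) →
              (∀ {x} → x ∈ xs → φ x ∈ ys) → (∀ {y} → y ∈ ys → ψ y ∈ xs) →
              (∀ {x} → x ∈ xs → ψ (φ x) ≡ x) → (∀ {y} → y ∈ ys → φ (ψ y) ≡ y) →
              (∀ {x} → x ∈ xs → f x ≡ g (φ x)) → ∑ xs f ≡ ∑ ys g
∑-bijection {xs = xs} {ys} {f} {g} uxs uys φ ψ φ∈ ψ∈ ψφ φψ eq = begin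
  ∑ xs f           ≡⟨ ∑-cong xs eq ⟩
  ∑ xs (g ∘ φ)     ≡⟨ ∑-map φ xs g ⟨
  ∑ (map φ xs) g   ≡⟨ sum-↭ (↭.map⁺ g (∼bag⇒↭ (unique∧set⇒bag (Unique-map inj uxs) uys (mk⇔ to from)))) ⟩
  ∑ ys g           ∎
  where
  inj : ∀ {x y} → x ∈ xs → y ∈ xs → φ x ≡ φ y → x ≡ y
  inj x∈ y∈ φx≡φy = trans (sym (ψφ x∈)) (trans (cong ψ φx≡φy) (ψφ y∈))
  to : ∀ {y} → y ∈ map φ xs → y ∈ ys
  to y∈ with ∈-map⁻ φ y∈
  ... | x , x∈ , refl = φ∈ x∈
  from : ∀ {y} → y ∈ ys → y ∈ map φ xs
  from y∈ = subst (_∈ map φ xs) (φψ y∈) (∈-map⁺ φ (ψ∈ y∈))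

module _ {P : A → Set} {Q : B → Set} (P? : (x : A) → Dec (P x)) (Q? : (y : B) → Dec (Q y)) where

  -- The two maps have to be mutually inverse only where the predicates hold. Orbits and tuples are
  -- matched this way, although most tuples are not orbits.
  ∑-⟦⟧-bijection : {xs : List A} {ys : List B} → Unique xs → Unique ys → (φ : A → B) (ψ : B → A) →
    (∀ {x} → x ∈ xs → P x → φ x ∈ ys × Q (φ x) × ψ (φ x) ≡ x) →
    (∀ {y} → y ∈ ys → Q y → ψ y ∈ xs × P (ψ y) × φ (ψ y) ≡ y) →
    ∑ xs (λ x → ⟦ P? x ⟧) ≡ ∑ ys (λ y → ⟦ Q? y ⟧)
  ∑-⟦⟧-bijection {xs} {ys} uxs uys φ ψ to from = begin
    ∑ xs (λ x → ⟦ P? x ⟧)          ≡⟨ length-filter P? xs ⟨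
    length (filter P? xs)          ≡⟨ length≡∑ (filter P? xs) ⟩
    ∑ (filter P? xs) (λ _ → 1)
      ≡⟨ ∑-bijection (Unique.filter⁺ P? uxs) (Unique.filter⁺ Q? uys) φ ψ
           (λ x∈ → let x∈xs , px = ∈-filter⁻ P? {xs = xs} x∈ ; φx∈ , qφx , _ = to x∈xs px in ∈-filter⁺ Q? φx∈ qφx)
           (λ y∈ → let y∈ys , qy = ∈-filter⁻ Q? {xs = ys} y∈ ; ψy∈ , pψy , _ = from y∈ys qy in ∈-filter⁺ P? ψy∈ pψy)
           (λ x∈ → let x∈xs , px = ∈-filter⁻ P? {xs = xs} x∈ in proj₂ (proj₂ (to x∈xs px)))
           (λ y∈ → let y∈ys , qy = ∈-filter⁻ Q? {xs = ys} y∈ in proj₂ (proj₂ (from y∈ys qy)))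
           (λ _ → refl) ⟩
    ∑ (filter Q? ys) (λ _ → 1)     ≡⟨ length≡∑ (filter Q? ys) ⟨
    length (filter Q? ys)          ≡⟨ length-filter Q? ys ⟩
    ∑ ys (λ y → ⟦ Q? y ⟧)          ∎

-- Permutations and injective tuples

Injective⇒Permutation : (f : Fin n → Fin n) → Injective _≡_ _≡_ f → Permutation′ n
Injective⇒Permutation {zero}  f inj = idₚ
Injective⇒Permutation {suc n} f inj = permutation f (proj₁ ∘ surj) (proj₂ ∘ surj) (λ x → inj (proj₂ (surj (f x))))
  where
  surj : ∀ y → ∃ λ x → f x ≡ y
  surj y with any? (λ x → f x ≟ y)
  ... | yes p = p
  -- With a missed value `y` punched out, `f` would embed `Fin (suc n)` into `Fin n`.
  ... | no ∄x = contradiction (injective⇒≤ (λ {i} {j} eq → inj (punchOut-injective (y≢ i) (y≢ j) eq))) 1+n≰n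
    where
    y≢ : ∀ x → y ≢ f x
    y≢ x y≡fx = ∄x (x , sym y≡fx)

Injective⇒Permutation-≗ : (f : Fin n → Fin n) (inj : Injective _≡_ _≡_ f) → ∀ i → Injective⇒Permutation f inj ⟨$⟩ʳ i ≡ f i
Injective⇒Permutation-≗ {suc n} f inj i = refl

⟨$⟩ʳ-injective : (g : Permutation′ n) → Injective _≡_ _≡_ (g ⟨$⟩ʳ_)
⟨$⟩ʳ-injective g eq = trans (sym (inverseˡ g)) (trans (cong (g ⟨$⟩ˡ_) eq) (inverseˡ g))

transpose-eqˡ : (i j : Fin n) → transpose i j ⟨$⟩ʳ i ≡ j
transpose-eqˡ i j rewrite dec-true (i ≟ i) refl = refl

transpose-eqʳ : (i j : Fin n) → transpose i j ⟨$⟩ʳ j ≡ i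
transpose-eqʳ i j with j ≟ i
... | yes j≡i = j≡i
... | no  _ rewrite dec-true (j ≟ j) refl = refl

transpose-≢ : {i j k : Fin n} → k ≢ i → k ≢ j → transpose i j ⟨$⟩ʳ k ≡ k
transpose-≢ {i = i} {j} {k} k≢i k≢j rewrite dec-false (k ≟ i) k≢i | dec-false (k ≟ j) k≢j = refl

Unique-toList⁺ : {A : Set} {v : Vec A m} → VUnique.Unique v → Unique (toList v)
Unique-toList⁺ VPairs.[]      = []
Unique-toList⁺ (x∉ VPairs.∷ u) = VAll.toList⁺ x∉ ∷ Unique-toList⁺ u

Unique-toList⁻ : {A : Set} (v : Vec A m) → Unique (toList v) → VUnique.Unique v
Unique-toList⁻ []       []       = VPairs.[]
Unique-toList⁻ (x ∷ v) (x∉ ∷ u) = VAll.toList⁻ x∉ VPairs.∷ Unique-toList⁻ v u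

concatMap-map : {A B C : Set} (f : A → B → C) (xs : List A) (ys : List B) →
                concatMap (λ x → map (f x) ys) xs ≡ cartesianProductWith f xs ys
concatMap-map f []       ys = refl
concatMap-map f (x ∷ xs) ys = cong (map (f x) ys ++_) (concatMap-map f xs ys)

allVecs-unique : ∀ m n → Unique (allVecs m n)
allVecs-unique zero    n = [] ∷ []
allVecs-unique (suc m) n = subst Unique (sym (concatMap-map _∷_ (allFin n) (allVecs m n)))
  (Unique.cartesianProductWith⁺ _∷_ Vec.∷-injective (Unique.allFin⁺ n) (allVecs-unique m n))

∈-allVecs : (v : Vec (Fin n) m) → v ∈ allVecs m n
∈-allVecs []      = here refl
∈-allVecs {n} {suc m} (x ∷ v) = subst (x ∷ v ∈_) (sym (concatMap-map _∷_ (allFin n) (allVecs m n)))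
  (∈-cartesianProductWith⁺ _∷_ (∈-allFin x) (∈-allVecs v))

distinct? : {A : Set} → ((x y : A) → Dec (x ≡ y)) → (xs : List A) → Dec (Unique xs)
distinct? _≟_ = allPairs? (λ x y → ¬? (x ≟ y))

-- tuples n n is definitionally perms n.
tuples : (m n : ℕ) → List (Vec (Fin n) m)
tuples m n = filter (λ v → distinct? _≟_ (toList v)) (allVecs m n)

tuples-unique : ∀ m n → Unique (tuples m n)
tuples-unique m n = Unique.filter⁺ (λ v → distinct? _≟_ (toList v)) (allVecs-unique m n)

∈-tuples⁺ : {v : Vec (Fin n) m} → Unique (toList v) → v ∈ tuples m n
∈-tuples⁺ {v = v} u = ∈-filter⁺ (λ v → distinct? _≟_ (toList v)) (∈-allVecs v) u

∈-tuples⁻ : {v : Vec (Fin n) m} → v ∈ tuples m n → Unique (toList v)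
∈-tuples⁻ {n} {m} v∈ = proj₂ (∈-filter⁻ (λ v → distinct? _≟_ (toList v)) {xs = allVecs m n} v∈)

perms-injective : {v : Vec (Fin n) n} → v ∈ perms n → Injective _≡_ _≡_ (lookup v)
perms-injective {v = v} v∈ {i} {j} = VUnique.lookup-injective (Unique-toList⁻ v (∈-tuples⁻ v∈)) i j

∈-perms : {f : Fin n → Fin n} → Injective _≡_ _≡_ f → tabulate f ∈ perms n
∈-perms inj = ∈-tuples⁺ (Unique-toList⁺ (VUnique.tabulate⁺ inj))

Extensional : ((Fin n → Fin n) → ℕ) → Set
Extensional F = ∀ {f g} → (∀ i → f i ≡ g i) → F f ≡ F g

-- Multiplication by `g` on the left and `h` on the right is a bijection of the symmetric group,
-- undone by their inverses. The twisted permutation is tabulated and looked up again, which returns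
-- the intended function only pointwise; hence `Extensional F`.
∑-perms-invariant : {F : (Fin n → Fin n) → ℕ} → Extensional F → (g h : Permutation′ n) →
  ∑ (perms n) (λ v → F (lookup v)) ≡ ∑ (perms n) (λ v → F (λ i → g ⟨$⟩ʳ lookup v (h ⟨$⟩ʳ i)))
∑-perms-invariant {n} {F} ext g h = sym (∑-bijection (tuples-unique n n) (tuples-unique n n)
    (twist g h) (twist (flip g) (flip h)) (twist-∈ g h) (twist-∈ (flip g) (flip h))
    (λ {v} _ → twist-inverse (flip g) (flip h) v) (λ {v} _ → twist-inverse g h v)
    (λ {v} _ → ext (λ i → sym (Vec.lookup∘tabulate _ i))))
  where
  twist : (g h : Permutation′ n) → Vec (Fin n) n → Vec (Fin n) n
  twist g h v = tabulate (λ i → g ⟨$⟩ʳ lookup v (h ⟨$⟩ʳ i))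
  twist-∈ : ∀ g h {v} → v ∈ perms n → twist g h v ∈ perms n
  twist-∈ g h v∈ = ∈-perms (λ eq → ⟨$⟩ʳ-injective h (perms-injective v∈ (⟨$⟩ʳ-injective g eq)))
  twist-inverse : ∀ g h v → twist g h (twist (flip g) (flip h) v) ≡ v
  twist-inverse g h v = begin
    twist g h (twist (flip g) (flip h) v)
      ≡⟨ Vec.tabulate-cong (λ i → trans
           (cong (g ⟨$⟩ʳ_) (trans (Vec.lookup∘tabulate _ (h ⟨$⟩ʳ i))
                                  (cong (λ j → g ⟨$⟩ˡ lookup v j) (inverseˡ h))))
           (inverseʳ g)) ⟩
    tabulate (lookup v)  ≡⟨ Vec.tabulate∘lookup v ⟩
    v                    ∎

-- Counting injective tuples

length-allFin : ∀ n → length (allFin n) ≡ n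
length-allFin n = length-tabulate id

∑-δ : (x : Fin n) (f : Fin n → ℕ) → ∑ (allFin n) (λ y → ⟦ y ≟ x ⟧ * f y) ≡ f x
∑-δ {n} x f = begin
  ∑ (allFin n) (λ y → ⟦ y ≟ x ⟧ * f y)
    ≡⟨ ∑-single _ (Unique.allFin⁺ n) (∈-allFin x) (λ {y} _ y≢x → cong (_* f y) (⟦⟧-no (y ≟ x) y≢x)) ⟩
  ⟦ x ≟ x ⟧ * f x  ≡⟨ cong (_* f x) (⟦⟧-yes (x ≟ x) refl) ⟩
  1 * f x          ≡⟨ *-identityˡ (f x) ⟩
  f x              ∎

∑-∈ : {xs : List (Fin n)} → Unique xs → ∑ (allFin n) (λ y → ⟦ _∈?_ _≟_ y xs ⟧) ≡ length xs
∑-∈ {n} {xs} u = begin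
  ∑ (allFin n) (λ y → ⟦ y ∈′ xs ⟧)                    ≡⟨ ∑-ext (allFin n) (λ y → count y) ⟨
  ∑ (allFin n) (λ y → ∑ xs (λ x → ⟦ y ≟ x ⟧ * 1))     ≡⟨ ∑-swap (allFin n) xs _ ⟩
  ∑ xs (λ x → ∑ (allFin n) (λ y → ⟦ y ≟ x ⟧ * 1))     ≡⟨ ∑-ext xs (λ x → ∑-δ x (λ _ → 1)) ⟩
  ∑ xs (λ _ → 1)                                      ≡⟨ length≡∑ xs ⟨
  length xs                                           ∎
  where
  _∈′_ = _∈?_ _≟_
  count : ∀ y → ∑ xs (λ x → ⟦ y ≟ x ⟧ * 1) ≡ ⟦ y ∈′ xs ⟧
  count y with y ∈′ xs
  ... | yes y∈ = begin
    ∑ xs (λ x → ⟦ y ≟ x ⟧ * 1)  ≡⟨ ∑-single _ u y∈ (λ {x} _ x≢y → cong (_* 1) (⟦⟧-no (y ≟ x) (x≢y ∘ sym))) ⟩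
    ⟦ y ≟ y ⟧ * 1               ≡⟨ cong (_* 1) (⟦⟧-yes (y ≟ y) refl) ⟩
    1                           ∎
  ... | no y∉ = trans (∑-cong xs (λ {x} x∈ → cong (_* 1) (⟦⟧-no (y ≟ x) (λ { refl → y∉ x∈ })))) (∑-zero xs)

length-toList : {A : Set} (v : Vec A m) → length (toList v) ≡ m
length-toList []      = refl
length-toList (x ∷ v) = cong suc (length-toList v)

∑-∉ : {v : Vec (Fin n) m} → Unique (toList v) → ∑ (allFin n) (λ y → ⟦ ¬? (_∈?_ _≟_ y (toList v)) ⟧) + m ≡ n
∑-∉ {n} {m} {v} u = begin
  ∑ (allFin n) (λ y → ⟦ ¬? (y ∈′ xs) ⟧) + m
    ≡⟨ cong (∑ (allFin n) (λ y → ⟦ ¬? (y ∈′ xs) ⟧) +_) (trans (∑-∈ u) (length-toList v)) ⟨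
  ∑ (allFin n) (λ y → ⟦ ¬? (y ∈′ xs) ⟧) + ∑ (allFin n) (λ y → ⟦ y ∈′ xs ⟧)
    ≡⟨ ∑-+ (allFin n) _ _ ⟨
  ∑ (allFin n) (λ y → ⟦ ¬? (y ∈′ xs) ⟧ + ⟦ y ∈′ xs ⟧)
    ≡⟨ ∑-ext (allFin n) (λ y → trans (+-comm ⟦ ¬? (y ∈′ xs) ⟧ _) (⟦⟧-¬ (y ∈′ xs))) ⟩
  ∑ (allFin n) (λ _ → 1)    ≡⟨ length≡∑ (allFin n) ⟨
  length (allFin n)         ≡⟨ length-allFin n ⟩
  n                         ∎
  where
  xs = toList v
  _∈′_ = _∈?_ _≟_

-- An injective tuple of length `suc m` arises from one of length `m` by a new head, for which the
-- `n ∸ m` points outside the tuple are available.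
length-tuples-suc : ∀ m n → length (tuples (suc m) n) ≡ length (tuples m n) * (n ∸ m)
length-tuples-suc m n = begin
  length (tuples (suc m) n)
    ≡⟨ length-filter (λ v → dist? (toList v)) (allVecs (suc m) n) ⟩
  ∑ (allVecs (suc m) n) (λ v → ⟦ dist? (toList v) ⟧)
    ≡⟨ ∑-concatMap (λ x → map (x ∷_) (allVecs m n)) (allFin n) _ ⟩
  ∑ (allFin n) (λ x → ∑ (map (x ∷_) (allVecs m n)) (λ v → ⟦ dist? (toList v) ⟧))
    ≡⟨ ∑-ext (allFin n) (λ x → ∑-map (x ∷_) (allVecs m n) _) ⟩
  ∑ (allFin n) (λ x → ∑ (allVecs m n) (λ v → ⟦ dist? (x ∷ toList v) ⟧))
    ≡⟨ ∑-swap (allFin n) (allVecs m n) _ ⟩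
  ∑ (allVecs m n) (λ v → ∑ (allFin n) (λ x → ⟦ dist? (x ∷ toList v) ⟧))
    ≡⟨ ∑-ext (allVecs m n) (λ v → trans (∑-ext (allFin n) (λ x → split x v))
                                         (∑-*ˡ (allFin n) ⟦ dist? (toList v) ⟧ _)) ⟩
  ∑ (allVecs m n) (λ v → ⟦ dist? (toList v) ⟧ * ∑ (allFin n) (λ x → ⟦ ¬? (_∈?_ _≟_ x (toList v)) ⟧))
    ≡⟨ ∑-ext (allVecs m n) (λ v → ⟦⟧*-cong (dist? (toList v)) (λ u →
         trans (sym (m+n∸n≡m _ m)) (cong (_∸ m) (∑-∉ {v = v} u)))) ⟩
  ∑ (allVecs m n) (λ v → ⟦ dist? (toList v) ⟧ * (n ∸ m))
    ≡⟨ ∑-*ʳ (allVecs m n) (n ∸ m) _ ⟩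
  ∑ (allVecs m n) (λ v → ⟦ dist? (toList v) ⟧) * (n ∸ m)
    ≡⟨ cong (_* (n ∸ m)) (length-filter (λ v → dist? (toList v)) (allVecs m n)) ⟨
  length (tuples m n) * (n ∸ m) ∎
  where
  dist? : (xs : List (Fin n)) → Dec (Unique xs)
  dist? = distinct? _≟_
  split : ∀ x (v : Vec (Fin n) m) → ⟦ dist? (x ∷ toList v) ⟧ ≡ ⟦ dist? (toList v) ⟧ * ⟦ ¬? (_∈?_ _≟_ x (toList v)) ⟧
  split x v = trans
    (⟦⟧-cong (dist? (x ∷ toList v)) (dist? (toList v) ×-dec ¬? (_∈?_ _≟_ x (toList v)))
      (λ { (x∉ ∷ u) → u , All.All¬⇒¬Any x∉ })
      (λ { (u , x∉) → All.¬Any⇒All¬ _ x∉ ∷ u }))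
    (⟦⟧-× (dist? (toList v)) (¬? (_∈?_ _≟_ x (toList v))))

-- The falling factorial in multiplicative form. The case `m` = `n` counts the permutations, and for
-- `m ≤ n` it shows that the number of tuples is nonzero and may be cancelled.
length-tuples-! : ∀ m n → m ≤ n → length (tuples m n) * (n ∸ m) ! ≡ n !
length-tuples-! zero    n m≤n = *-identityˡ (n !)
length-tuples-! (suc m) n m<n = begin
  length (tuples (suc m) n) * (n ∸ suc m) !          ≡⟨ cong (_* (n ∸ suc m) !) (length-tuples-suc m n) ⟩
  length (tuples m n) * (n ∸ m) * (n ∸ suc m) !      ≡⟨ *-assoc (length (tuples m n)) _ _ ⟩
  length (tuples m n) * ((n ∸ m) * (n ∸ suc m) !)    ≡⟨ cong (λ k → length (tuples m n) * (k * (n ∸ suc m) !)) (sym n∸m≡) ⟩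
  length (tuples m n) * (suc (n ∸ suc m)) !          ≡⟨ cong (λ k → length (tuples m n) * k !) n∸m≡ ⟩
  length (tuples m n) * (n ∸ m) !                    ≡⟨ length-tuples-! m n (<⇒≤ m<n) ⟩
  n !                                                ∎
  where
  n∸m≡ : suc (n ∸ suc m) ≡ n ∸ m
  n∸m≡ = sym (+-∸-assoc 1 m<n)

length-perms : ∀ n → length (perms n) ≡ n !
length-perms n = begin
  length (perms n)                ≡⟨ *-identityʳ _ ⟨
  length (perms n) * 0 !          ≡⟨ cong (λ k → length (perms n) * k !) (n∸n≡0 n) ⟨
  length (perms n) * (n ∸ n) !    ≡⟨ length-tuples-! n n ≤-refl ⟩
  n !                             ∎

length-tuples≢0 : m ≤ n → NonZero (length (tuples m n))
length-tuples≢0 {m} {n} m≤n = m*n≢0⇒m≢0 _ {{subst NonZero (sym (length-tuples-! m n m≤n)) (n !≢0)}}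

-- Action of permutations on injective tuples

_≟ᵥ_ : (t u : Vec (Fin n) m) → Dec (t ≡ u)
_≟ᵥ_ = Vec.≡-dec _≟_

map-fixes : {A : Set} {f : A → A} (v : Vec A m) → (∀ {x} → x ∈ toList v → f x ≡ x) → Vec.map f v ≡ v
map-fixes []      fix = refl
map-fixes (x ∷ v) fix = cong₂ _∷_ (fix (here refl)) (map-fixes v (fix ∘ there))

Unique-toList-map : {A B : Set} {f : A → B} {v : Vec A m} → Injective _≡_ _≡_ f → Unique (toList v) → Unique (toList (Vec.map f v))
Unique-toList-map {f = f} {v} inj u = subst Unique (sym (Vec.toList-map f v)) (Unique.map⁺ inj u)

-- Once `g` takes the tail of the one tuple to the tail of the other, a transposition corrects the
-- head. It exchanges the image of `x` with `y`, both of which lie outside the tail `u` by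
-- distinctness, so the part already matched is left alone.
permutations-transitive : (t u : Vec (Fin n) m) → Unique (toList t) → Unique (toList u) →
                          ∃ λ (g : Permutation′ n) → Vec.map (g ⟨$⟩ʳ_) t ≡ u
permutations-transitive []      []      _         _         = idₚ , refl
permutations-transitive (x ∷ t) (y ∷ u) ut@(_ ∷ ut′) (y∉u ∷ uu)
  with g , refl ← permutations-transitive t u ut′ uu
  with gx∉ ∷ _ ← Unique-toList-map {v = x ∷ t} (⟨$⟩ʳ-injective g) ut
  = g ∘ₚ h , cong₂ _∷_ (transpose-eqˡ gx y) (begin
      Vec.map ((g ∘ₚ h) ⟨$⟩ʳ_) t                  ≡⟨ Vec.map-∘ (h ⟨$⟩ʳ_) (g ⟨$⟩ʳ_) t ⟩
      Vec.map (h ⟨$⟩ʳ_) (Vec.map (g ⟨$⟩ʳ_) t)     ≡⟨ map-fixes _ (λ w∈ → transpose-≢ (All.lookup gx∉ w∈ ∘ sym) (All.lookup y∉u w∈ ∘ sym)) ⟩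
      Vec.map (g ⟨$⟩ʳ_) t                         ∎)
  where
  gx = g ⟨$⟩ʳ x
  h = transpose gx y

#carrying : Vec (Fin n) m → Vec (Fin n) m → ℕ
#carrying {n} t u = ∑ (perms n) (λ v → ⟦ Vec.map (lookup v) t ≟ᵥ u ⟧)

-- Composition with some `g` taking `u` to `u′` matches the permutations that carry `t` to `u` with
-- those that carry `t` to `u′`.
#carrying-const : (t u u′ : Vec (Fin n) m) → Unique (toList u) → Unique (toList u′) → #carrying t u ≡ #carrying t u′
#carrying-const {n} t u u′ uu uu′ with g , gu≡u′ ← permutations-transitive u u′ uu uu′ = begin
  ∑ (perms n) (λ v → ⟦ Vec.map (lookup v) t ≟ᵥ u ⟧)
    ≡⟨ ∑-ext (perms n) (λ v → ⟦⟧-cong (Vec.map (lookup v) t ≟ᵥ u) (Vec.map (λ i → g ⟨$⟩ʳ lookup v i) t ≟ᵥ u′) (to v) (from v)) ⟩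
  ∑ (perms n) (λ v → ⟦ Vec.map (λ i → g ⟨$⟩ʳ lookup v i) t ≟ᵥ u′ ⟧)
    ≡⟨ ∑-perms-invariant (λ f≗f′ → cong (λ s → ⟦ s ≟ᵥ u′ ⟧) (Vec.map-cong f≗f′ t)) g idₚ ⟨
  ∑ (perms n) (λ v → ⟦ Vec.map (lookup v) t ≟ᵥ u′ ⟧)  ∎
  where
  to : ∀ v → Vec.map (lookup v) t ≡ u → Vec.map (λ i → g ⟨$⟩ʳ lookup v i) t ≡ u′
  to v eq = trans (Vec.map-∘ (g ⟨$⟩ʳ_) (lookup v) t) (trans (cong (Vec.map (g ⟨$⟩ʳ_)) eq) gu≡u′)
  from : ∀ v → Vec.map (λ i → g ⟨$⟩ʳ lookup v i) t ≡ u′ → Vec.map (lookup v) t ≡ u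
  from v eq = begin
    Vec.map (lookup v) t  ≡⟨ map-fixes _ (λ _ → inverseˡ g) ⟨
    Vec.map (λ i → g ⟨$⟩ˡ (g ⟨$⟩ʳ i)) (Vec.map (lookup v) t)
      ≡⟨ Vec.map-∘ (g ⟨$⟩ˡ_) (g ⟨$⟩ʳ_) _ ⟩
    Vec.map (g ⟨$⟩ˡ_) (Vec.map (g ⟨$⟩ʳ_) (Vec.map (lookup v) t))
      ≡⟨ cong (Vec.map (g ⟨$⟩ˡ_)) (trans (sym (Vec.map-∘ (g ⟨$⟩ʳ_) (lookup v) t)) (trans eq (sym gu≡u′))) ⟩
    Vec.map (g ⟨$⟩ˡ_) (Vec.map (g ⟨$⟩ʳ_) u)  ≡⟨ Vec.map-∘ (g ⟨$⟩ˡ_) (g ⟨$⟩ʳ_) u ⟨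
    Vec.map (λ i → g ⟨$⟩ˡ (g ⟨$⟩ʳ i)) u      ≡⟨ map-fixes u (λ _ → inverseˡ g) ⟩
    u  ∎

-- Averaging: #carrying t u does not depend on u, so Σ_t #carrying t (ρ t) is the mean
-- over ρ t of Σ_t Σ_u #carrying t u, in which every permutation is counted once per t.
∑-#tuples-moved-by : m ≤ n → (ρ : Vec (Fin n) m → Vec (Fin n) m) →
  (∀ {t} → Unique (toList t) → Unique (toList (ρ t))) →
  ∑ (perms n) (λ v → ∑ (tuples m n) (λ t → ⟦ Vec.map (lookup v) t ≟ᵥ ρ t ⟧)) ≡ n !
∑-#tuples-moved-by {m} {n} m≤n ρ ρ-unique = *-cancelˡ-≡ _ _ N {{length-tuples≢0 m≤n}} (begin
  N * ∑ (perms n) (λ v → ∑ T (λ t → ⟦ Vec.map (lookup v) t ≟ᵥ ρ t ⟧))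
    ≡⟨ cong (N *_) (∑-swap (perms n) T _) ⟩
  N * ∑ T (λ t → #carrying t (ρ t))
    ≡⟨ ∑-*ˡ T N _ ⟨
  ∑ T (λ t → N * #carrying t (ρ t))
    ≡⟨ ∑-ext T (λ t → ∑-const T _) ⟨
  ∑ T (λ t → ∑ T (λ u → #carrying t (ρ t)))
    ≡⟨ ∑-cong T (λ {t} t∈ → ∑-cong T (λ {u} u∈ →
         #carrying-const t (ρ t) u (ρ-unique (∈-tuples⁻ t∈)) (∈-tuples⁻ u∈))) ⟩
  ∑ T (λ t → ∑ T (λ u → #carrying t u))
    ≡⟨ ∑-ext T (λ t → ∑-swap T (perms n) _) ⟩
  ∑ T (λ t → ∑ (perms n) (λ v → ∑ T (λ u → ⟦ Vec.map (lookup v) t ≟ᵥ u ⟧)))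
    ≡⟨ ∑-cong T (λ t∈ → ∑-cong (perms n) (λ v∈ → single t∈ v∈)) ⟩
  ∑ T (λ t → ∑ (perms n) (λ v → 1))
    ≡⟨ ∑-const T _ ⟩
  N * ∑ (perms n) (λ v → 1)
    ≡⟨ cong (N *_) (trans (sym (length≡∑ (perms n))) (length-perms n)) ⟩
  N * n !  ∎)
  where
  T = tuples m n
  N = length T
  single : ∀ {t v} → t ∈ T → v ∈ perms n → ∑ T (λ u → ⟦ Vec.map (lookup v) t ≟ᵥ u ⟧) ≡ 1
  single {t} {v} t∈ v∈ = trans
    (∑-single _ (tuples-unique m n)
      (∈-tuples⁺ (Unique-toList-map {v = t} (perms-injective v∈) (∈-tuples⁻ t∈)))
      (λ {u} _ u≢ → ⟦⟧-no (Vec.map (lookup v) t ≟ᵥ u) (u≢ ∘ sym)))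
    (⟦⟧-yes (Vec.map (lookup v) t ≟ᵥ Vec.map (lookup v) t) refl)

-- Cycles

∈-divisors⁺ : ∀ {d k} .{{_ : NonZero k}} → d ∣ k → d ∈ divisors k
∈-divisors⁺ {zero}  {k} d∣k@(divides q k≡q*0) = contradiction (trans k≡q*0 (*-zeroʳ q)) (≢-nonZero⁻¹ k)
∈-divisors⁺ {suc d} {k} d∣k = ∈-filter⁺ (_∣? k) (∈-map⁺ suc (∈-upTo⁺ (∣⇒≤ d∣k))) d∣k

∈-divisors⁻ : ∀ {d} k → d ∈ divisors k → NonZero d × d ≤ k × d ∣ k
∈-divisors⁻ k d∈ with d∈′ , d∣k ← ∈-filter⁻ (_∣? k) {xs = map suc (upTo k)} d∈
                 with _ , i∈ , refl ← ∈-map⁻ suc d∈′ = nonZero , ∈-upTo⁻ i∈ , d∣k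

divisors-unique : ∀ k → Unique (divisors k)
divisors-unique k = Unique.filter⁺ (_∣? k) (Unique.map⁺ suc-injective (Unique.upTo⁺ k))

Unique-resp-↭ : {A : Set} {xs ys : List A} → xs ↭ ys → Unique xs → Unique ys
Unique-resp-↭ xs↭ys = ↭ₛ.Unique-resp-↭ (setoid _) (↭⇒↭ₛ xs↭ys)

Unique-++⁻ : {A : Set} (xs : List A) {ys : List A} → Unique (xs ++ ys) → Unique xs × Unique ys × Disjoint xs ys
Unique-++⁻ []       u        = [] , u , λ ()
Unique-++⁻ (x ∷ xs) (x∉ ∷ u) with uxs , uys , disjoint ← Unique-++⁻ xs u =
  All.++⁻ˡ xs x∉ ∷ uxs , uys ,
  λ { (here refl , x∈ys) → All.lookup (All.++⁻ʳ xs x∉) x∈ys refl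
    ; (there z∈xs , z∈ys) → disjoint (z∈xs , z∈ys) }

-- Orbits and shifted tuples

take-++ : {A : Set} {d e : ℕ} (t : Vec A d) (u : Vec A e) → Vec.take d (t Vec.++ u) ≡ t
take-++ []      u = refl
take-++ (x ∷ t) u = cong (x ∷_) (take-++ t u)

drop-++ : {A : Set} {d e : ℕ} (t : Vec A d) (u : Vec A e) → Vec.drop d (t Vec.++ u) ≡ u
drop-++ []      u = refl
drop-++ (x ∷ t) u = drop-++ t u

-- Applying `f` to a cycle x, f x, f (f x), ... shifts the list by one place. For injective `t`, the
-- equation `Vec.map f t ≡ rotate t` therefore says that `t` lists a cycle of `f`.
rotate : {A : Set} {d : ℕ} → Vec A d → Vec A d
rotate []      = []
rotate (x ∷ t) = t Vec.∷ʳ x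

-- The same encoding for two cycles written one after the other, the former of length `d`.
rotate₂ : {A : Set} (d : ℕ) {e : ℕ} → Vec A (d + e) → Vec A (d + e)
rotate₂ d t = rotate (Vec.take d t) Vec.++ rotate (Vec.drop d t)

rotate-↭ : {A : Set} {d : ℕ} (t : Vec A d) → toList t ↭ toList (rotate t)
rotate-↭ []      = ↭-refl
rotate-↭ (x ∷ t) = ↭-trans (↭.∷↭∷ʳ x (toList t)) (↭-reflexive (sym (Vec.toList-∷ʳ x t)))

rotate₂-↭ : {A : Set} (d : ℕ) {e : ℕ} (t : Vec A (d + e)) → toList t ↭ toList (rotate₂ d t)
rotate₂-↭ d t =
  ↭-trans (↭-reflexive (trans (cong toList (sym (Vec.take++drop≡id d t))) (Vec.toList-++ (Vec.take d t) (Vec.drop d t))))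
  (↭-trans (↭.++⁺ (rotate-↭ (Vec.take d t)) (rotate-↭ (Vec.drop d t)))
           (↭-reflexive (sym (Vec.toList-++ (rotate (Vec.take d t)) (rotate (Vec.drop d t))))))

module _ {A : Set} (f : A → A) where

  iter-suc : ∀ k x → iter k f (f x) ≡ f (iter k f x)
  iter-suc zero    x = refl
  iter-suc (suc k) x = cong f (iter-suc k x)

  iter-+ : ∀ a b x → iter (a + b) f x ≡ iter a f (iter b f x)
  iter-+ zero    b x = refl
  iter-+ (suc a) b x = cong f (iter-+ a b x)

  iter-periodic : ∀ {d x} q → iter d f x ≡ x → iter (q * d) f x ≡ x
  iter-periodic         zero    eq = refl
  iter-periodic {d} {x} (suc q) eq = trans (iter-+ d (q * d) x) (trans (cong (iter d f) (iter-periodic q eq)) eq)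

  iter-% : ∀ {d x} .{{_ : NonZero d}} m → iter d f x ≡ x → iter m f x ≡ iter (m ℕ.% d) f x
  iter-% {d} {x} m eq = begin
    iter m f x                            ≡⟨ cong (λ k → iter k f x) (m≡m%n+[m/n]*n m d) ⟩
    iter (m ℕ.% d + m ℕ./ d * d) f x          ≡⟨ iter-+ (m ℕ.% d) (m ℕ./ d * d) x ⟩
    iter (m ℕ.% d) f (iter (m ℕ./ d * d) f x) ≡⟨ cong (iter (m ℕ.% d) f) (iter-periodic (m ℕ./ d) eq) ⟩
    iter (m ℕ.% d) f x                      ∎

  orbit : (d : ℕ) → A → Vec A d
  orbit zero    x = []
  orbit (suc d) x = x ∷ orbit d (f x)

  ∈-orbit⁺ : ∀ {d i} x → i < d → iter i f x ∈ toList (orbit d x)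
  ∈-orbit⁺ {suc d} {zero}  x i<d       = here refl
  ∈-orbit⁺ {suc d} {suc i} x (s≤s i<d) = there (subst (_∈ toList (orbit d (f x))) (iter-suc i x) (∈-orbit⁺ (f x) i<d))

  ∈-orbit⁻ : ∀ {d x z} → z ∈ toList (orbit d x) → ∃ λ i → i < d × z ≡ iter i f x
  ∈-orbit⁻ {suc d}     (here refl) = 0 , s≤s z≤n , refl
  ∈-orbit⁻ {suc d} {x} (there z∈) with i , i<d , refl ← ∈-orbit⁻ {d} z∈ = suc i , s≤s i<d , iter-suc i x

  orbit-∷ʳ : ∀ d x → orbit (suc d) x ≡ orbit d x Vec.∷ʳ iter d f x
  orbit-∷ʳ zero    x = refl
  orbit-∷ʳ (suc d) x = cong (x ∷_) (trans (orbit-∷ʳ d (f x)) (cong (orbit d (f x) Vec.∷ʳ_) (iter-suc d x)))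

  map-orbit : ∀ d x → Vec.map f (orbit d x) ≡ orbit d (f x)
  map-orbit zero    x = refl
  map-orbit (suc d) x = cong (f x ∷_) (map-orbit d (f x))

  orbit-rotates : ∀ d {x} → iter d f x ≡ x → Vec.map f (orbit d x) ≡ rotate (orbit d x)
  orbit-rotates zero        eq = refl
  orbit-rotates (suc d) {x} eq = begin
    Vec.map f (orbit (suc d) x)             ≡⟨ map-orbit (suc d) x ⟩
    orbit (suc d) (f x)                     ≡⟨ orbit-∷ʳ d (f x) ⟩
    orbit d (f x) Vec.∷ʳ iter d f (f x)     ≡⟨ cong (orbit d (f x) Vec.∷ʳ_) (trans (iter-suc d x) eq) ⟩
    orbit d (f x) Vec.∷ʳ x                  ∎

  -- The last entry `z` is kept independent of `x`, because the induction replaces `x` by `f x`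
  -- while the end of the tuple stays the same. Taking `z` = `x` closes the cycle.
  shifts⇒orbit : ∀ {d} x {z} (t : Vec A d) → Vec.map f (x ∷ t) ≡ t Vec.∷ʳ z → t ≡ orbit d (f x) × iter (suc d) f x ≡ z
  shifts⇒orbit x []      eq = refl , Vec.∷-injectiveˡ eq
  shifts⇒orbit {suc d} x (y ∷ t) eq with refl , eq′ ← Vec.∷-injective eq with t≡ , z≡ ← shifts⇒orbit (f x) t eq′ =
    cong (f x ∷_) t≡ , trans (cong f (sym (iter-suc d x))) z≡

  rotates⇒orbit : ∀ {d} (t : Vec A (suc d)) → Vec.map f t ≡ rotate t →
                  t ≡ orbit (suc d) (Vec.head t) × iter (suc d) f (Vec.head t) ≡ Vec.head t
  rotates⇒orbit (x ∷ t) eq with t≡ , x≡ ← shifts⇒orbit x t eq = cong (x ∷_) t≡ , x≡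

-- Exact periods and fixed points of powers

module Cycles {n : ℕ} (f : Fin n → Fin n) where

  -- Distinctness of the `d` listed points makes `d` the exact length of the cycle through `x`. Both
  -- conditions are trivial for `d` = 0, hence the `NonZero` hypotheses below.
  HasPeriod : ℕ → Fin n → Set
  HasPeriod d x = iter d f x ≡ x × Unique (toList (orbit f d x))

  hasPeriod? : ∀ d x → Dec (HasPeriod d x)
  hasPeriod? d x = (iter d f x ≟ x) ×-dec distinct? _≟_ (toList (orbit f d x))

  fixes? : ∀ k x → Dec (iter k f x ≡ x)
  fixes? k x = iter k f x ≟ x

  _∈orbit?_ : ∀ y {d} (t : Vec (Fin n) d) → Dec (y ∈ toList t)
  y ∈orbit? t = _∈?_ _≟_ y (toList t)

  #fixed : ℕ → ℕ
  #fixed k = ∑ (allFin n) (λ x → ⟦ fixes? k x ⟧)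

  #hasPeriod : ℕ → ℕ
  #hasPeriod d = ∑ (allFin n) (λ x → ⟦ hasPeriod? d x ⟧)

  #separated : ℕ → ℕ → ℕ
  #separated d e = ∑ (allFin n) (λ x → ∑ (allFin n) (λ y →
    ⟦ hasPeriod? d x ⟧ * (⟦ hasPeriod? e y ⟧ * ⟦ ¬? (y ∈orbit? orbit f d x) ⟧)))

  module _ (f-injective : Injective _≡_ _≡_ f) where

    -- An equality between the head and a later entry is an early return of `x`. For the tail,
    -- injectivity turns a return of `f x` into a return of `x`, so the hypothesis passes on.
    orbit-unique : ∀ d {x} → (∀ e → 0 < e → e < d → iter e f x ≢ x) → Unique (toList (orbit f d x))
    orbit-unique zero        min = []
    orbit-unique (suc d) {x} min =
      All.tabulate (λ z∈ x≡z → let i , i<d , z≡ = ∈-orbit⁻ f {d} z∈ in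
        min (suc i) (s≤s z≤n) (s≤s i<d) (trans (sym (iter-suc f i x)) (trans (sym z≡) (sym x≡z))))
      ∷ orbit-unique d (λ e 0<e e<d eq → min e 0<e (m<n⇒m<1+n e<d) (f-injective (trans (sym (iter-suc f e x)) eq)))

    HasPeriod-minimal : ∀ {d e x} → HasPeriod d x → 0 < e → e < d → iter e f x ≢ x
    HasPeriod-minimal {suc d} {suc e} {x} (_ , x∉ ∷ _) _ (s≤s e<d) eq =
      All.lookup x∉ (∈-orbit⁺ f (f x) e<d) (sym (trans (iter-suc f e x) eq))

    -- A nonzero remainder of `m` modulo `d` would be a positive return time below the period.
    HasPeriod⇒∣ : ∀ {d x} .{{_ : NonZero d}} m → HasPeriod d x → iter m f x ≡ x → d ∣ m
    HasPeriod⇒∣ {d} {x} m per@(eq , _) eqₘ with m ℕ.% d in m%d≡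
    ... | zero  = m%n≡0⇒n∣m m d m%d≡
    ... | suc r = contradiction
      (trans (sym (trans (iter-% f m eq) (cong (λ k → iter k f x) m%d≡))) eqₘ)
      (HasPeriod-minimal per (s≤s z≤n) (subst (_< d) m%d≡ (m%n<n m d)))

    -- Descent on positive return times: one that admits no smaller is the exact period.
    ∃-period : ∀ m {x} → 0 < m → iter m f x ≡ x → ∃ λ d → NonZero d × HasPeriod d x
    ∃-period = <-rec _ step
      where
      step : ∀ m → (∀ {e} → e < m → ∀ {x} → 0 < e → iter e f x ≡ x → ∃ λ d → NonZero d × HasPeriod d x) →
             ∀ {x} → 0 < m → iter m f x ≡ x → ∃ λ d → NonZero d × HasPeriod d x
      step m rec {x} 0<m eq with anyUpTo? (λ e → (0 <? e) ×-dec (iter e f x ≟ x)) m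
      ... | yes (e , e<m , 0<e , eqₑ) = rec e<m 0<e eqₑ
      ... | no  ∄e = m , >-nonZero 0<m , eq , orbit-unique m (λ e 0<e e<m eqₑ → ∄e (e , e<m , 0<e , eqₑ))

    HasPeriod-fixes : ∀ {d x} k → d ∣ k → HasPeriod d x → iter k f x ≡ x
    HasPeriod-fixes k (divides q refl) (eq , _) = iter-periodic f q eq

    -- The period of a point fixed by the `k`-th iterate divides `k`, and it is unique because two
    -- periods divide each other. So at most one summand is nonzero.
    fixes-divisors : ∀ k .{{_ : NonZero k}} x → ⟦ fixes? k x ⟧ ≡ ∑ (divisors k) (λ d → ⟦ hasPeriod? d x ⟧)
    fixes-divisors k x with fixes? k x
    ... | no  fᵏx≢x = sym (trans
      (∑-cong (divisors k) (λ {d} d∈ → ⟦⟧-no (hasPeriod? d x) (fᵏx≢x ∘ HasPeriod-fixes k (proj₂ (proj₂ (∈-divisors⁻ k d∈))))))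
      (∑-zero (divisors k)))
    ... | yes fᵏx≡x with d , d≢0 , per ← ∃-period k (>-nonZero⁻¹ k) fᵏx≡x = sym (trans
      (∑-single _ (divisors-unique k) (∈-divisors⁺ (HasPeriod⇒∣ {{d≢0}} k per fᵏx≡x))
        (λ {e} e∈ e≢d → ⟦⟧-no (hasPeriod? e x) (λ per′ → e≢d (∣-antisym
          (HasPeriod⇒∣ {{proj₁ (∈-divisors⁻ k e∈)}} d per′ (proj₁ per))
          (HasPeriod⇒∣ {{d≢0}} e per (proj₁ per′))))))
      (⟦⟧-yes (hasPeriod? d x) per))

    orbit-closed : ∀ {d x} .{{_ : NonZero d}} j → HasPeriod d x → iter j f x ∈ toList (orbit f d x)
    orbit-closed {d} {x} j (eq , _) = subst (_∈ toList (orbit f d x)) (sym (iter-% f j eq)) (∈-orbit⁺ f x (m%n<n j d))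

    ∈-orbit-fixes : ∀ {d x y} k → d ∣ k → HasPeriod d x → y ∈ toList (orbit f d x) → iter k f y ≡ y
    ∈-orbit-fixes {d} {x} k d∣k per y∈ with i , _ , refl ← ∈-orbit⁻ f {d} y∈ = begin
      iter k f (iter i f x)  ≡⟨ iter-+ f k i x ⟨
      iter (k + i) f x       ≡⟨ cong (λ j → iter j f x) (+-comm k i) ⟩
      iter (i + k) f x       ≡⟨ iter-+ f i k x ⟩
      iter i f (iter k f x)  ≡⟨ cong (iter i f) (HasPeriod-fixes k d∣k per) ⟩
      iter i f x             ∎

    -- From a common point, `e ∸ j` further applications of `f` complete the cycle of `y` and reach
    -- `y`, which would then lie on the orbit of `x`.
    orbits-disjoint : ∀ {d e x y} .{{_ : NonZero d}} → HasPeriod d x → HasPeriod e y → y ∉ toList (orbit f d x) →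
                      Disjoint (toList (orbit f d x)) (toList (orbit f e y))
    orbits-disjoint {d} {e} {x} {y} perx (pery , _) y∉ (z∈ , z∈′)
      with i , _ , refl ← ∈-orbit⁻ f {d} z∈ with j , j<e , fⁱx≡fʲy ← ∈-orbit⁻ f {e} z∈′ =
      y∉ (subst (_∈ toList (orbit f d x)) (begin
        iter (e ∸ j + i) f x         ≡⟨ iter-+ f (e ∸ j) i x ⟩
        iter (e ∸ j) f (iter i f x)  ≡⟨ cong (iter (e ∸ j) f) fⁱx≡fʲy ⟩
        iter (e ∸ j) f (iter j f y)  ≡⟨ iter-+ f (e ∸ j) j y ⟨
        iter (e ∸ j + j) f y         ≡⟨ cong (λ k → iter k f y) (m∸n+n≡m (<⇒≤ j<e)) ⟩
        iter e f y                   ≡⟨ pery ⟩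
        y                            ∎)
        (orbit-closed (e ∸ j + i) perx))

    -- A cycle can be read from any of its points, and the head of the tuple recovers the starting
    -- point. Each cycle of length `suc d` thus counts `suc d` times on both sides.
    #hasPeriod≡#tuples : ∀ d → #hasPeriod (suc d) ≡ ∑ (tuples (suc d) n) (λ t → ⟦ Vec.map f t ≟ᵥ rotate t ⟧)
    #hasPeriod≡#tuples d = ∑-⟦⟧-bijection (hasPeriod? (suc d)) (λ t → Vec.map f t ≟ᵥ rotate t)
      (Unique.allFin⁺ n) (tuples-unique (suc d) n) (orbit f (suc d)) Vec.head
      (λ { _ (eq , u) → ∈-tuples⁺ u , orbit-rotates f (suc d) eq , refl })
      (λ {t} t∈ rot → let t≡ , eq = rotates⇒orbit f t rot in
        ∈-allFin _ , (eq , subst (Unique ∘ toList) t≡ (∈-tuples⁻ t∈)) , sym t≡)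

    -- Distinctness of the whole concatenated tuple encodes both exact periods and the disjointness
    -- of the two cycles.
    #separated≡#tuples : ∀ d e →
      #separated (suc d) (suc e) ≡ ∑ (tuples (suc d + suc e) n) (λ t → ⟦ Vec.map f t ≟ᵥ rotate₂ (suc d) t ⟧)
    #separated≡#tuples d e = begin
      #separated (suc d) (suc e)
        ≡⟨ ∑-cartesianProduct (allFin n) (allFin n) _ ⟨
      ∑ (cartesianProduct (allFin n) (allFin n)) (λ (x , y) →
        ⟦ hasPeriod? (suc d) x ⟧ * (⟦ hasPeriod? (suc e) y ⟧ * ⟦ ¬? (y ∈orbit? orbit f (suc d) x) ⟧))
        ≡⟨ ∑-ext (cartesianProduct (allFin n) (allFin n)) (λ (x , y) → trans
             (⟦⟧-× (hasPeriod? (suc d) x) (hasPeriod? (suc e) y ×-dec ¬? (y ∈orbit? orbit f (suc d) x)))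
             (cong (⟦ hasPeriod? (suc d) x ⟧ *_) (⟦⟧-× (hasPeriod? (suc e) y) (¬? (y ∈orbit? orbit f (suc d) x))))) ⟨
      ∑ (cartesianProduct (allFin n) (allFin n)) (λ p → ⟦ separated? p ⟧)
        ≡⟨ ∑-⟦⟧-bijection separated? (λ t → Vec.map f t ≟ᵥ rotate₂ (suc d) t)
             (Unique.cartesianProduct⁺ (Unique.allFin⁺ n) (Unique.allFin⁺ n)) (tuples-unique (suc d + suc e) n)
             φ ψ (λ _ → to) (λ {t} t∈ → from t (∈-tuples⁻ t∈)) ⟩
      ∑ (tuples (suc d + suc e) n) (λ t → ⟦ Vec.map f t ≟ᵥ rotate₂ (suc d) t ⟧)  ∎
      where
      Separated : Fin n × Fin n → Set
      Separated (x , y) = HasPeriod (suc d) x × HasPeriod (suc e) y × y ∉ toList (orbit f (suc d) x)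
      separated? : ∀ p → Dec (Separated p)
      separated? (x , y) = hasPeriod? (suc d) x ×-dec (hasPeriod? (suc e) y ×-dec ¬? (y ∈orbit? orbit f (suc d) x))
      φ : Fin n × Fin n → Vec (Fin n) (suc d + suc e)
      φ (x , y) = orbit f (suc d) x Vec.++ orbit f (suc e) y
      ψ : Vec (Fin n) (suc d + suc e) → Fin n × Fin n
      ψ t = Vec.head (Vec.take (suc d) t) , Vec.head (Vec.drop (suc d) t)
      to : ∀ {p} → Separated p → φ p ∈ tuples (suc d + suc e) n × Vec.map f (φ p) ≡ rotate₂ (suc d) (φ p) × ψ (φ p) ≡ p
      to {x , y} (perx@(eqx , ux) , pery@(eqy , uy) , y∉) =
        ∈-tuples⁺ (subst Unique (sym (Vec.toList-++ ox oy)) (Unique.++⁺ ux uy (orbits-disjoint {suc d} {suc e} perx pery y∉))) ,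
        (begin
          Vec.map f (ox Vec.++ oy)             ≡⟨ Vec.map-++ f ox oy ⟩
          Vec.map f ox Vec.++ Vec.map f oy     ≡⟨ cong₂ Vec._++_ (orbit-rotates f (suc d) eqx) (orbit-rotates f (suc e) eqy) ⟩
          rotate ox Vec.++ rotate oy           ≡⟨ cong₂ (λ t u → rotate t Vec.++ rotate u) (take-++ ox oy) (drop-++ ox oy) ⟨
          rotate₂ (suc d) (ox Vec.++ oy)       ∎) ,
        cong₂ _,_ refl (cong Vec.head (drop-++ ox oy))
        where
        ox = orbit f (suc d) x
        oy = orbit f (suc e) y
      from : ∀ t → Unique (toList t) → Vec.map f t ≡ rotate₂ (suc d) t →
             ψ t ∈ cartesianProduct (allFin n) (allFin n) × Separated (ψ t) × φ (ψ t) ≡ t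
      from t u rot
        with eq₁ , eq₂ ← Vec.++-injective (Vec.map f (Vec.take (suc d) t)) (rotate (Vec.take (suc d) t))
               (trans (sym (Vec.map-++ f (Vec.take (suc d) t) (Vec.drop (suc d) t)))
                      (trans (cong (Vec.map f) (Vec.take++drop≡id (suc d) t)) rot))
        with t₁≡ , per₁ ← rotates⇒orbit f (Vec.take (suc d) t) eq₁
        with t₂≡ , per₂ ← rotates⇒orbit f (Vec.drop (suc d) t) eq₂
        with u₁ , u₂ , disjoint ← Unique-++⁻ (toList (Vec.take (suc d) t))
               (subst Unique (trans (cong toList (sym (Vec.take++drop≡id (suc d) t)))
                                    (Vec.toList-++ (Vec.take (suc d) t) (Vec.drop (suc d) t))) u) =
        ∈-cartesianProduct⁺ (∈-allFin _) (∈-allFin _) ,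
        ((per₁ , subst (Unique ∘ toList) t₁≡ u₁) , (per₂ , subst (Unique ∘ toList) t₂≡ u₂) ,
         λ y∈ → disjoint (subst (y ∈_) (cong toList (sym t₁≡)) y∈ ,
                          subst (y ∈_) (cong toList (sym t₂≡)) (here refl))) ,
        trans (cong₂ Vec._++_ (sym t₁≡) (sym t₂≡)) (Vec.take++drop≡id (suc d) t)
        where
        y = proj₂ (ψ t)

    #fixed-divisors : ∀ k .{{_ : NonZero k}} → #fixed k ≡ ∑ (divisors k) #hasPeriod
    #fixed-divisors k = trans (∑-ext (allFin n) (fixes-divisors k)) (∑-swap (allFin n) (divisors k) _)

    -- All `d` points on the cycle of `x` are fixed by the `k`-th iterate since `d ∣ k`; the fixed
    -- points off this cycle are sorted by their own period `e`.
    #fixed-split : ∀ k .{{_ : NonZero k}} {d x} → d ∣ k → HasPeriod d x →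
      #fixed k ≡ d + ∑ (divisors k) (λ e → ∑ (allFin n) (λ y → ⟦ hasPeriod? e y ⟧ * ⟦ ¬? (y ∈orbit? orbit f d x) ⟧))
    #fixed-split k {d} {x} d∣k per@(_ , u) = begin
      #fixed k
        ≡⟨ ∑-ext (allFin n) (λ y → split y) ⟩
      ∑ (allFin n) (λ y → inside y + ∑ (divisors k) (λ e → ⟦ hasPeriod? e y ⟧ * outside y))
        ≡⟨ ∑-+ (allFin n) _ _ ⟩
      ∑ (allFin n) inside + ∑ (allFin n) (λ y → ∑ (divisors k) (λ e → ⟦ hasPeriod? e y ⟧ * outside y))
        ≡⟨ cong₂ _+_ (trans (∑-∈ u) (length-toList (orbit f d x))) (∑-swap (allFin n) (divisors k) _) ⟩
      d + ∑ (divisors k) (λ e → ∑ (allFin n) (λ y → ⟦ hasPeriod? e y ⟧ * outside y))  ∎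
      where
      inside outside : Fin n → ℕ
      inside  y = ⟦ y ∈orbit? orbit f d x ⟧
      outside y = ⟦ ¬? (y ∈orbit? orbit f d x) ⟧
      split : ∀ y → ⟦ fixes? k y ⟧ ≡ inside y + ∑ (divisors k) (λ e → ⟦ hasPeriod? e y ⟧ * outside y)
      split y with y ∈orbit? orbit f d x
      ... | yes y∈ = trans (⟦⟧-yes (fixes? k y) (∈-orbit-fixes {d} k d∣k per y∈))
        (cong suc (sym (trans (∑-ext (divisors k) (λ e → *-zeroʳ ⟦ hasPeriod? e y ⟧)) (∑-zero (divisors k)))))
      ... | no  y∉ = trans (fixes-divisors k y) (∑-ext (divisors k) (λ e → sym (*-identityʳ ⟦ hasPeriod? e y ⟧)))

    -- An ordered pair of fixed points lies on one cycle or on two. With a first point of period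
    -- `d`, the former kind has `d` choices for the second point and the latter is counted by
    -- `#separated`.
    #fixed²-divisors : ∀ k .{{_ : NonZero k}} →
      #fixed k * #fixed k ≡ ∑ (divisors k) (λ d → #hasPeriod d * d)
                            + ∑ (divisors k) (λ d → ∑ (divisors k) (#separated d))
    #fixed²-divisors k = begin
      #fixed k * #fixed k
        ≡⟨ cong (_* #fixed k) (#fixed-divisors k) ⟩
      ∑ D #hasPeriod * #fixed k
        ≡⟨ ∑-*ʳ D (#fixed k) #hasPeriod ⟨
      ∑ D (λ d → #hasPeriod d * #fixed k)
        ≡⟨ ∑-cong D (λ {d} d∈ → expand d (proj₂ (proj₂ (∈-divisors⁻ k d∈)))) ⟩
      ∑ D (λ d → #hasPeriod d * d + ∑ D (#separated d))
        ≡⟨ ∑-+ D _ _ ⟩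
      ∑ D (λ d → #hasPeriod d * d) + ∑ D (λ d → ∑ D (#separated d))  ∎
      where
      D = divisors k
      expand : ∀ d → d ∣ k → #hasPeriod d * #fixed k ≡ #hasPeriod d * d + ∑ D (#separated d)
      expand d d∣k = begin
        #hasPeriod d * #fixed k
          ≡⟨ ∑-*ʳ (allFin n) (#fixed k) _ ⟨
        ∑ (allFin n) (λ x → ⟦ hasPeriod? d x ⟧ * #fixed k)
          ≡⟨ ∑-ext (allFin n) (λ x → ⟦⟧*-cong (hasPeriod? d x) (#fixed-split k d∣k)) ⟩
        ∑ (allFin n) (λ x → ⟦ hasPeriod? d x ⟧ * (d + ∑ D (λ e → ∑ (allFin n) (others d x e))))
          ≡⟨ ∑-ext (allFin n) (λ x → *-distribˡ-+ ⟦ hasPeriod? d x ⟧ d _) ⟩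
        ∑ (allFin n) (λ x → ⟦ hasPeriod? d x ⟧ * d + ⟦ hasPeriod? d x ⟧ * ∑ D (λ e → ∑ (allFin n) (others d x e)))
          ≡⟨ ∑-+ (allFin n) _ _ ⟩
        ∑ (allFin n) (λ x → ⟦ hasPeriod? d x ⟧ * d)
          + ∑ (allFin n) (λ x → ⟦ hasPeriod? d x ⟧ * ∑ D (λ e → ∑ (allFin n) (others d x e)))
          ≡⟨ cong₂ _+_ (∑-*ʳ (allFin n) d _) (trans
               (∑-ext (allFin n) (λ x → sym (trans
                 (∑-ext D (λ e → ∑-*ˡ (allFin n) ⟦ hasPeriod? d x ⟧ (others d x e)))
                 (∑-*ˡ D ⟦ hasPeriod? d x ⟧ _))))
               (∑-swap (allFin n) D _)) ⟩
        #hasPeriod d * d + ∑ D (#separated d)  ∎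
        where
        others : ℕ → Fin n → ℕ → Fin n → ℕ
        others d x e y = ⟦ hasPeriod? e y ⟧ * ⟦ ¬? (y ∈orbit? orbit f d x) ⟧

-- Order patterns of random permutations

⟦<⟧+⟦>⟧ : {a b : ℕ} → a ≢ b → ⟦ a <? b ⟧ + ⟦ b <? a ⟧ ≡ 1
⟦<⟧+⟦>⟧ {a} {b} a≢b with <-cmp a b
... | tri< a<b _ a≯b = cong₂ _+_ (⟦⟧-yes (a <? b) a<b) (⟦⟧-no (b <? a) a≯b)
... | tri≈ _ a≡b _   = contradiction a≡b a≢b
... | tri> a≮b _ a>b = cong₂ _+_ (⟦⟧-no (a <? b) a≮b) (⟦⟧-yes (b <? a) a>b)

-- Exactly one of three distinct numbers is the smallest. Two of the eight comparison patterns are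
-- cyclic and contradict transitivity.
⟦minimum⟧ : {a b c : ℕ} → a ≢ b → a ≢ c → b ≢ c →
            ⟦ a <? b ⟧ * ⟦ a <? c ⟧ + (⟦ b <? a ⟧ * ⟦ b <? c ⟧ + ⟦ c <? b ⟧ * ⟦ c <? a ⟧) ≡ 1
⟦minimum⟧ {a} {b} {c} a≢b a≢c b≢c with <-cmp a b | <-cmp a c | <-cmp b c
... | tri≈ _ e _ | _ | _ = contradiction e a≢b
... | _ | tri≈ _ e _ | _ = contradiction e a≢c
... | _ | _ | tri≈ _ e _ = contradiction e b≢c
... | tri< p _ p′ | tri< q _ q′ | tri< r _ r′
  rewrite ⟦⟧-yes (a <? b) p | ⟦⟧-no (b <? a) p′ | ⟦⟧-yes (a <? c) q | ⟦⟧-no (c <? a) q′ | ⟦⟧-no (c <? b) r′ = refl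
... | tri< p _ p′ | tri< q _ q′ | tri> r _ r′
  rewrite ⟦⟧-yes (a <? b) p | ⟦⟧-no (b <? a) p′ | ⟦⟧-yes (a <? c) q | ⟦⟧-no (c <? a) q′ | ⟦⟧-yes (c <? b) r′ = refl
... | tri< p _ p′ | tri> q _ q′ | tri< r _ r′ = contradiction (<-trans p r) q
... | tri< p _ p′ | tri> q _ q′ | tri> r _ r′
  rewrite ⟦⟧-yes (a <? b) p | ⟦⟧-no (b <? a) p′ | ⟦⟧-no (a <? c) q | ⟦⟧-yes (c <? a) q′ | ⟦⟧-yes (c <? b) r′ = refl
... | tri> p _ p′ | tri< q _ q′ | tri< r _ r′
  rewrite ⟦⟧-no (a <? b) p | ⟦⟧-yes (b <? a) p′ | ⟦⟧-no (c <? a) q′ | ⟦⟧-yes (b <? c) r | ⟦⟧-no (c <? b) r′ = refl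
... | tri> p _ p′ | tri< q _ q′ | tri> r _ r′ = contradiction (<-trans q r′) p
... | tri> p _ p′ | tri> q _ q′ | tri< r _ r′
  rewrite ⟦⟧-no (a <? b) p | ⟦⟧-yes (b <? a) p′ | ⟦⟧-yes (c <? a) q′ | ⟦⟧-yes (b <? c) r | ⟦⟧-no (c <? b) r′ = refl
... | tri> p _ p′ | tri> q _ q′ | tri> r _ r′
  rewrite ⟦⟧-no (a <? b) p | ⟦⟧-yes (b <? a) p′ | ⟦⟧-yes (c <? a) q′ | ⟦⟧-no (b <? c) r | ⟦⟧-yes (c <? b) r′ = refl

module _ {n : ℕ} where

  lt : (Fin n → Fin n) → Fin n → Fin n → ℕ
  lt f x y = ⟦ toℕ (f x) <? toℕ (f y) ⟧

  #< : Fin n → Fin n → ℕ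
  #< x y = ∑ (perms n) (λ v → lt (lookup v) x y)

  -- This is n! times the probability that a random relabelling increases from `x` to `y` and from
  -- `z` to `w`. Inversions of `f` under relabelling are the case `#<< x y (f y) (f x)`.
  #<< : (x y z w : Fin n) → ℕ
  #<< x y z w = ∑ (perms n) (λ v → lt (lookup v) x y * lt (lookup v) z w)

  toℕ-perms-≢ : ∀ {x y v} → v ∈ perms n → x ≢ y → toℕ (lookup v x) ≢ toℕ (lookup v y)
  toℕ-perms-≢ v∈ x≢y = x≢y ∘ perms-injective v∈ ∘ toℕ-injective

  -- Precomposing every permutation with `h` renames the points, so only the coincidences among the
  -- four arguments matter.
  #<<-relabel : (h : Permutation′ n) {x y z w x′ y′ z′ w′ : Fin n} →
    h ⟨$⟩ʳ x ≡ x′ → h ⟨$⟩ʳ y ≡ y′ → h ⟨$⟩ʳ z ≡ z′ → h ⟨$⟩ʳ w ≡ w′ → #<< x y z w ≡ #<< x′ y′ z′ w′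
  #<<-relabel h {x} {y} {z} {w} refl refl refl refl =
    ∑-perms-invariant {F = λ f → lt f x y * lt f z w}
      (λ f≗g → cong₂ _*_ (cong₂ (λ a b → ⟦ toℕ a <? toℕ b ⟧) (f≗g x) (f≗g y))
                         (cong₂ (λ a b → ⟦ toℕ a <? toℕ b ⟧) (f≗g z) (f≗g w)))
      idₚ h

  #<<-comm : ∀ x y z w → #<< x y z w ≡ #<< z w x y
  #<<-comm x y z w = ∑-ext (perms n) (λ v → *-comm (lt (lookup v) x y) _)

  #<<-diag : ∀ x y → #<< x y x y ≡ #< x y
  #<<-diag x y = ∑-ext (perms n) (λ v → idem (toℕ (lookup v x) <? toℕ (lookup v y)))
    where
    idem : {P : Set} (d : Dec P) → ⟦ d ⟧ * ⟦ d ⟧ ≡ ⟦ d ⟧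
    idem (yes _) = refl
    idem (no _)  = refl

  #<<-irrefl : ∀ x z w → #<< x x z w ≡ 0
  #<<-irrefl x z w = trans
    (∑-ext (perms n) (λ v → cong (_* lt (lookup v) z w) (⟦⟧-no (toℕ (lookup v x) <? toℕ (lookup v x)) (<-irrefl refl))))
    (∑-zero (perms n))

  #<<-asym : ∀ x y → #<< x y y x ≡ 0
  #<<-asym x y = trans (∑-ext (perms n) (λ v → zero-product (toℕ (lookup v x)) (toℕ (lookup v y)))) (∑-zero (perms n))
    where
    zero-product : ∀ a b → ⟦ a <? b ⟧ * ⟦ b <? a ⟧ ≡ 0
    zero-product a b with <-cmp a b
    ... | tri< _ _ a≯b = trans (cong (⟦ a <? b ⟧ *_) (⟦⟧-no (b <? a) a≯b)) (*-zeroʳ ⟦ a <? b ⟧)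
    ... | tri≈ a≮b _ _ = cong (_* ⟦ b <? a ⟧) (⟦⟧-no (a <? b) a≮b)
    ... | tri> a≮b _ _ = cong (_* ⟦ b <? a ⟧) (⟦⟧-no (a <? b) a≮b)

  #<<-total : ∀ {x y} z w → x ≢ y → #<< x y z w + #<< y x z w ≡ #< z w
  #<<-total {x} {y} z w x≢y = begin
    #<< x y z w + #<< y x z w
      ≡⟨ ∑-+ (perms n) _ _ ⟨
    ∑ (perms n) (λ v → lt (lookup v) x y * lt (lookup v) z w + lt (lookup v) y x * lt (lookup v) z w)
      ≡⟨ ∑-cong (perms n) (λ {v} v∈ → trans
           (sym (*-distribʳ-+ (lt (lookup v) z w) (lt (lookup v) x y) (lt (lookup v) y x)))
           (trans (cong (_* lt (lookup v) z w) (⟦<⟧+⟦>⟧ (toℕ-perms-≢ v∈ x≢y))) (*-identityˡ _))) ⟩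
    #< z w  ∎

  2#< : ∀ {x y} → x ≢ y → 2 * #< x y ≡ n !
  2#< {x} {y} x≢y = begin
    2 * #< x y             ≡⟨ cong (#< x y +_) (+-identityʳ _) ⟩
    #< x y + #< x y        ≡⟨ cong (#< x y +_) (begin
       -- The single comparison is doubled so that `#<<-relabel` also serves for exchanging `x` and
       -- `y`.
       #< x y        ≡⟨ #<<-diag x y ⟨
       #<< x y x y   ≡⟨ #<<-relabel (transpose x y) x↦ y↦ x↦ y↦ ⟩
       #<< y x y x   ≡⟨ #<<-diag y x ⟩
       #< y x        ∎) ⟩
    #< x y + #< y x        ≡⟨ ∑-+ (perms n) _ _ ⟨
    ∑ (perms n) (λ v → lt (lookup v) x y + lt (lookup v) y x)
                           ≡⟨ ∑-cong (perms n) (λ v∈ → ⟦<⟧+⟦>⟧ (toℕ-perms-≢ v∈ x≢y)) ⟩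
    ∑ (perms n) (λ _ → 1)  ≡⟨ length≡∑ (perms n) ⟨
    length (perms n)       ≡⟨ length-perms n ⟩
    n !                    ∎
    where
    x↦ = transpose-eqˡ x y
    y↦ = transpose-eqʳ x y

  -- Exchanging `x` and `y` does not touch `z` and `w`, so each order of `x`, `y` accounts for half
  -- of `#< z w`.
  4#<<-disjoint : ∀ {x y z w} → x ≢ y → z ≢ w → z ≢ x → z ≢ y → w ≢ x → w ≢ y → 4 * #<< x y z w ≡ n !
  4#<<-disjoint {x} {y} {z} {w} x≢y z≢w z≢x z≢y w≢x w≢y = begin
    4 * #<< x y z w                          ≡⟨ double (#<< x y z w) ⟩
    2 * (#<< x y z w + #<< x y z w)          ≡⟨ cong (λ k → 2 * (#<< x y z w + k)) flipped ⟩
    2 * (#<< x y z w + #<< y x z w)          ≡⟨ cong (2 *_) (#<<-total z w x≢y) ⟩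
    2 * #< z w                               ≡⟨ 2#< z≢w ⟩
    n !                                      ∎
    where
    double : ∀ a → 4 * a ≡ 2 * (a + a)
    double = solve-∀
    flipped = #<<-relabel (transpose x y) (transpose-eqˡ x y) (transpose-eqʳ x y) (transpose-≢ z≢x z≢y) (transpose-≢ w≢x w≢y)

  -- The pattern says that `x` receives the smallest of three labels; transpositions show that each
  -- point does so equally often.
  3#<<-min : ∀ {x y z} → x ≢ y → x ≢ z → y ≢ z → 3 * #<< x y x z ≡ n !
  3#<<-min {x} {y} {z} x≢y x≢z y≢z = begin
    3 * #<< x y x z
      ≡⟨ triple (#<< x y x z) ⟩
    #<< x y x z + (#<< x y x z + #<< x y x z)
      ≡⟨ cong (#<< x y x z +_) (cong₂ _+_
           (#<<-relabel (transpose x y) (transpose-eqˡ x y) (transpose-eqʳ x y) (transpose-eqˡ x y) (transpose-≢ (x≢z ∘ sym) (y≢z ∘ sym)))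
           (#<<-relabel (transpose x z) (transpose-eqˡ x z) (transpose-≢ (x≢y ∘ sym) y≢z) (transpose-eqˡ x z) (transpose-eqʳ x z))) ⟩
    #<< x y x z + (#<< y x y z + #<< z y z x)
      ≡⟨ cong (#<< x y x z +_) (∑-+ (perms n) _ _) ⟨
    #<< x y x z + ∑ (perms n) (λ v → lt (lookup v) y x * lt (lookup v) y z + lt (lookup v) z y * lt (lookup v) z x)
      ≡⟨ ∑-+ (perms n) _ _ ⟨
    ∑ (perms n) (λ v → lt (lookup v) x y * lt (lookup v) x z
                       + (lt (lookup v) y x * lt (lookup v) y z + lt (lookup v) z y * lt (lookup v) z x))
      ≡⟨ ∑-cong (perms n) (λ v∈ → ⟦minimum⟧ (toℕ-perms-≢ v∈ x≢y) (toℕ-perms-≢ v∈ x≢z) (toℕ-perms-≢ v∈ y≢z)) ⟩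
    ∑ (perms n) (λ _ → 1)
      ≡⟨ length≡∑ (perms n) ⟨
    length (perms n)
      ≡⟨ length-perms n ⟩
    n !  ∎
    where
    triple : ∀ a → 3 * a ≡ a + (a + a)
    triple = solve-∀

  -- Among the relabellings with `y` below `z`, either `x` lies below `y`, which is the chain, or
  -- `y` is the smallest of the three. Hence 1/6 = 1/2 - 1/3; adding `2 * n !` to both sides avoids
  -- the subtraction.
  6#<<-chain : ∀ {x y z} → x ≢ y → x ≢ z → y ≢ z → 6 * #<< x y y z ≡ n !
  6#<<-chain {x} {y} {z} x≢y x≢z y≢z = +-cancelˡ-≡ (2 * n !) _ _ (begin
    2 * n ! + 6 * #<< x y y z                ≡⟨ cong (λ k → 2 * k + 6 * #<< x y y z) (3#<<-min (x≢y ∘ sym) y≢z x≢z) ⟨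
    2 * (3 * #<< y x y z) + 6 * #<< x y y z  ≡⟨ regroup (#<< y x y z) (#<< x y y z) ⟩
    3 * (2 * (#<< x y y z + #<< y x y z))    ≡⟨ cong (λ k → 3 * (2 * k)) (#<<-total y z x≢y) ⟩
    3 * (2 * #< y z)                         ≡⟨ cong (3 *_) (2#< y≢z) ⟩
    3 * n !                                  ≡⟨ +-comm (n !) (2 * n !) ⟩
    2 * n ! + n !                            ∎)
    where
    regroup : ∀ a b → 2 * (3 * a) + 6 * b ≡ 3 * (2 * (b + a))
    regroup = solve-∀

  -- Among the relabellings with `y` below `x`, either `x` lies below `z`, a chain, or `x` is the
  -- largest of the three. Hence 1/3 = 1/2 - 1/6.
  3#<<-max : ∀ {x y z} → x ≢ y → x ≢ z → y ≢ z → 3 * #<< y x z x ≡ n !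
  3#<<-max {x} {y} {z} x≢y x≢z y≢z = *-cancelˡ-≡ _ _ 2 (+-cancelʳ-≡ (n !) _ _ (begin
    2 * (3 * #<< y x z x) + n !                    ≡⟨ cong₂ (λ a b → 2 * (3 * a) + b) (#<<-comm y x z x) (sym (6#<<-chain (x≢y ∘ sym) y≢z x≢z)) ⟩
    2 * (3 * #<< z x y x) + 6 * #<< y x x z        ≡⟨ cong (λ a → 2 * (3 * #<< z x y x) + 6 * a) (#<<-comm y x x z) ⟩
    2 * (3 * #<< z x y x) + 6 * #<< x z y x        ≡⟨ regroup (#<< z x y x) (#<< x z y x) ⟩
    3 * (2 * (#<< x z y x + #<< z x y x))          ≡⟨ cong (λ k → 3 * (2 * k)) (#<<-total y x x≢z) ⟩
    3 * (2 * #< y x)                               ≡⟨ cong (3 *_) (2#< (x≢y ∘ sym)) ⟩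
    3 * n !                                        ≡⟨ +-comm (n !) (2 * n !) ⟩
    2 * n ! + n !                                  ∎))
    where
    regroup : ∀ a b → 2 * (3 * a) + 6 * b ≡ 3 * (2 * (b + a))
    regroup = solve-∀

  -- A pattern of probability 1/c contributes d = 12/c after scaling by 12, and `e` is the total of
  -- the correction terms kept on the left. The cases below use this with (d, c) = (2, 6), (3, 4),
  -- (4, 3) and (6, 2).
  rescale : ∀ d c q e {N} → c * q ≡ N → d * c * q + N * e ≡ N * (d + e)
  rescale d c q e refl = expand d c q e
    where
    expand : ∀ d c q e → d * c * q + c * q * e ≡ c * q * (d + e)
    expand = solve-∀

  -- One identity covers all coincidence patterns of two points x, y with their images a, b.
  12#<< : ∀ x y a b → (x ≡ y → a ≡ b) → (a ≡ b → x ≡ y) →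
    12 * #<< x y b a + n ! * (⟦ a ≟ x ⟧ + ⟦ b ≟ y ⟧ + ⟦ a ≟ x ⟧ * ⟦ b ≟ y ⟧ + 3 * ⟦ x ≟ y ⟧)
      ≡ n ! * (3 + ⟦ a ≟ y ⟧ + ⟦ b ≟ x ⟧ + ⟦ a ≟ y ⟧ * ⟦ b ≟ x ⟧)
  12#<< x y a b f-cong f-inj with x ≟ y
  ... | yes refl with refl ← f-cong refl = begin
    12 * #<< x x a a + n ! * (δ + δ + δ * δ + 3 * 1)  ≡⟨ cong (λ k → 12 * k + n ! * (δ + δ + δ * δ + 3 * 1)) (#<<-irrefl x a a) ⟩
    n ! * (δ + δ + δ * δ + 3 * 1)                     ≡⟨ cong (n ! *_) (regroup δ) ⟩
    n ! * (3 + δ + δ + δ * δ)                         ∎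
    where
    δ = ⟦ a ≟ x ⟧
    regroup : ∀ c → c + c + c * c + 3 * 1 ≡ 3 + c + c + c * c
    regroup = solve-∀
  ... | no x≢y with a ≟ x
  ...   | yes refl rewrite ⟦⟧-no (x ≟ y) x≢y | ⟦⟧-no (b ≟ x) (x≢y ∘ f-inj ∘ sym) with b ≟ y
  ...     | yes refl = cong (λ k → 12 * k + n ! * 3) (#<<-asym x y)
  ...     | no b≢y = trans
    (cong (λ k → 12 * k + n ! * 1) (#<<-comm x y b x))
    (rescale 2 6 (#<< b x x y) 1 (6#<<-chain (x≢y ∘ f-inj ∘ sym) b≢y x≢y))
  12#<< x y a b f-cong f-inj | no x≢y | no a≢x with b ≟ y
  ... | yes refl rewrite ⟦⟧-no (a ≟ y) (x≢y ∘ f-inj) | ⟦⟧-no (y ≟ x) (x≢y ∘ sym) =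
    rescale 2 6 (#<< x y y a) 1 (6#<<-chain x≢y (a≢x ∘ sym) (x≢y ∘ f-inj ∘ sym))
  ... | no b≢y with a ≟ y | b ≟ x
  ...   | yes refl | yes refl = trans (cong (λ k → 12 * k + n ! * 0) (#<<-diag x y)) (rescale 6 2 (#< x y) 0 (2#< x≢y))
  ...   | yes refl | no b≢x = rescale 4 3 (#<< x y b y) 0 (3#<<-max (x≢y ∘ sym) (b≢y ∘ sym) (b≢x ∘ sym))
  ...   | no a≢y | yes refl = rescale 4 3 (#<< x y x a) 0 (3#<<-min x≢y (a≢x ∘ sym) (a≢y ∘ sym))
  ...   | no a≢y | no b≢x = rescale 3 4 (#<< x y b a) 0 (4#<<-disjoint x≢y (x≢y ∘ f-inj ∘ sym) b≢x b≢y a≢x a≢y)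

-- Averages over the symmetric group

open Cycles

#fixed-double : ∀ (f : Fin n → Fin n) k → ∑ (allFin n) (λ x → ⟦ iter k f (iter k f x) ≟ x ⟧) ≡ #fixed f (k + k)
#fixed-double {n} f k = ∑-ext (allFin n) (λ x → cong (λ y → ⟦ y ≟ x ⟧) (sym (iter-+ f k k x)))

∑-#hasPeriod : ∀ {d} .{{_ : NonZero d}} → d ≤ n → ∑ (perms n) (λ v → #hasPeriod (lookup v) d) ≡ n !
∑-#hasPeriod {n} {suc d} d≤n = trans
  (∑-cong (perms n) (λ {v} v∈ → #hasPeriod≡#tuples (lookup v) (perms-injective v∈) d))
  (∑-#tuples-moved-by d≤n rotate (λ {t} → Unique-resp-↭ (rotate-↭ t)))

∑-#separated : ∀ {d e} .{{_ : NonZero d}} .{{_ : NonZero e}} → d + e ≤ n → ∑ (perms n) (λ v → #separated (lookup v) d e) ≡ n !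
∑-#separated {n} {suc d} {suc e} d+e≤n = trans
  (∑-cong (perms n) (λ {v} v∈ → #separated≡#tuples (lookup v) (perms-injective v∈) d e))
  (∑-#tuples-moved-by d+e≤n (rotate₂ (suc d)) (λ {t} → Unique-resp-↭ (rotate₂-↭ (suc d) t)))

∑-#fixed : ∀ k .{{_ : NonZero k}} → k ≤ n → ∑ (perms n) (λ v → #fixed (lookup v) k) ≡ τ k * n !
∑-#fixed {n} k k≤n = begin
  ∑ (perms n) (λ v → #fixed (lookup v) k)
    ≡⟨ ∑-cong (perms n) (λ {v} v∈ → #fixed-divisors (lookup v) (perms-injective v∈) k) ⟩
  ∑ (perms n) (λ v → ∑ (divisors k) (#hasPeriod (lookup v)))
    ≡⟨ ∑-swap (perms n) (divisors k) _ ⟩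
  ∑ (divisors k) (λ d → ∑ (perms n) (λ v → #hasPeriod (lookup v) d))
    ≡⟨ ∑-cong (divisors k) (λ d∈ → let d≢0 , d≤k , _ = ∈-divisors⁻ k d∈ in ∑-#hasPeriod {{d≢0}} (≤-trans d≤k k≤n)) ⟩
  ∑ (divisors k) (λ _ → n !)
    ≡⟨ ∑-const (divisors k) (n !) ⟩
  τ k * n !  ∎

-- Each divisor `d` contributes `d` times n! through pairs on a common cycle, and each pair of
-- divisors contributes n! through pairs on disjoint cycles, for which `k + k ≤ n` leaves room.
∑-#fixed² : ∀ k .{{_ : NonZero k}} → k + k ≤ n →
            ∑ (perms n) (λ v → #fixed (lookup v) k * #fixed (lookup v) k) ≡ n ! * σ k + τ k * (τ k * n !)
∑-#fixed² {n} k 2k≤n = begin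
  ∑ (perms n) (λ v → #fixed (lookup v) k * #fixed (lookup v) k)
    ≡⟨ ∑-cong (perms n) (λ {v} v∈ → #fixed²-divisors (lookup v) (perms-injective v∈) k) ⟩
  ∑ (perms n) (λ v → ∑ D (λ d → #hasPeriod (lookup v) d * d) + ∑ D (λ d → ∑ D (#separated (lookup v) d)))
    ≡⟨ ∑-+ (perms n) _ _ ⟩
  ∑ (perms n) (λ v → ∑ D (λ d → #hasPeriod (lookup v) d * d)) + ∑ (perms n) (λ v → ∑ D (λ d → ∑ D (#separated (lookup v) d)))
    ≡⟨ cong₂ _+_ (∑-swap (perms n) D _)
                 (trans (∑-swap (perms n) D _) (∑-ext D (λ d → ∑-swap (perms n) D _))) ⟩
  ∑ D (λ d → ∑ (perms n) (λ v → #hasPeriod (lookup v) d * d))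
    + ∑ D (λ d → ∑ D (λ e → ∑ (perms n) (λ v → #separated (lookup v) d e)))
    ≡⟨ cong₂ _+_
         (∑-cong D (λ {d} d∈ → let d≢0 , d≤k , _ = ∈-divisors⁻ k d∈ in
           trans (∑-*ʳ (perms n) d _) (cong (_* d) (∑-#hasPeriod {{d≢0}} (≤-trans d≤k (≤-trans (m≤m+n k k) 2k≤n))))))
         (∑-cong D (λ d∈ → ∑-cong D (λ e∈ →
           let d≢0 , d≤k , _ = ∈-divisors⁻ k d∈ ; e≢0 , e≤k , _ = ∈-divisors⁻ k e∈ in
           ∑-#separated {{d≢0}} {{e≢0}} (≤-trans (+-mono-≤ d≤k e≤k) 2k≤n)))) ⟩
  ∑ D (λ d → n ! * d) + ∑ D (λ d → ∑ D (λ e → n !))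
    ≡⟨ cong₂ _+_ (trans (∑-*ˡ D (n !) id) (cong (λ ds → n ! * sum ds) (map-id D)))
                 (trans (∑-const D _) (cong (τ k *_) (∑-const D (n !)))) ⟩
  n ! * σ k + τ k * (τ k * n !)  ∎
  where
  D = divisors k

-- Divisors of twice a number

odd⇒Coprime-2 : ∀ {d} → ¬ 2 ∣ d → Coprime d 2
odd⇒Coprime-2 2∤d {0} (_ , divides q 2≡q*0) = contradiction (trans 2≡q*0 (*-zeroʳ q)) λ ()
odd⇒Coprime-2 2∤d {1} _ = refl
odd⇒Coprime-2 2∤d {2} (2∣d , _) = contradiction 2∣d 2∤d
odd⇒Coprime-2 2∤d {suc (suc (suc i))} (_ , i∣2) with s≤s (s≤s ()) ← ∣⇒≤ i∣2

-- Halving matches the even divisors of 2k with all divisors of `k`. An odd divisor of 2k is coprime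
-- to 2 and so already divides `k`.
τ-double : ∀ k .{{_ : NonZero k}} → τ (k + k) ≡ τ k + τₒ k
τ-double k = begin
  τ (k + k)
    ≡⟨ length≡∑ D₂ ⟩
  ∑ D₂ (λ _ → 1)
    ≡⟨ ∑-ext D₂ (λ d → ⟦⟧-¬ (2 ∣? d)) ⟨
  ∑ D₂ (λ d → ⟦ 2 ∣? d ⟧ + ⟦ ¬? (2 ∣? d) ⟧)
    ≡⟨ ∑-+ D₂ _ _ ⟩
  ∑ D₂ (λ d → ⟦ 2 ∣? d ⟧) + ∑ D₂ (λ d → ⟦ ¬? (2 ∣? d) ⟧)
    ≡⟨ cong₂ _+_ even odd ⟩
  ∑ D (λ _ → 1) + ∑ D (λ d → ⟦ ¬? (2 ∣? d) ⟧)
    ≡⟨ cong₂ _+_ (length≡∑ D) (length-filter (λ d → ¬? (2 ∣? d)) D) ⟨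
  τ k + τₒ k  ∎
  where
  D = divisors k
  D₂ = divisors (k + k)
  double : k + k ≡ k * 2
  double = trans (cong (k +_) (sym (+-identityʳ k))) (*-comm 2 k)
  instance
    k+k≢0 : NonZero (k + k)
    k+k≢0 = subst NonZero (sym double) (m*n≢0 k 2)
  ∣k : ∀ {d} → d ∈ D → d ∣ k
  ∣k d∈ = proj₂ (proj₂ (∈-divisors⁻ k d∈))
  ∣k*2 : ∀ {d} → d ∈ D₂ → d ∣ k * 2
  ∣k*2 {d} d∈ = subst (d ∣_) double (proj₂ (proj₂ (∈-divisors⁻ (k + k) d∈)))
  ∈D₂ : ∀ {d} → d ∣ k * 2 → d ∈ D₂
  ∈D₂ {d} d∣ = ∈-divisors⁺ (subst (d ∣_) (sym double) d∣)
  even : ∑ D₂ (λ d → ⟦ 2 ∣? d ⟧) ≡ ∑ D (λ _ → 1)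
  even = ∑-⟦⟧-bijection (2 ∣?_) (λ _ → yes tt) (divisors-unique (k + k)) (divisors-unique k) (ℕ._/ 2) (_* 2)
    (λ { d∈ (divides q refl) → ∈-divisors⁺ (subst (_∣ k) (sym (m*n/n≡m q 2)) (*-cancelʳ-∣ 2 (∣k*2 d∈)))
                             , tt , cong (_* 2) (m*n/n≡m q 2) })
    (λ {d} d∈ _ → ∈D₂ (*-monoˡ-∣ 2 (∣k d∈)) , n∣m*n d , m*n/n≡m d 2)
  odd : ∑ D₂ (λ d → ⟦ ¬? (2 ∣? d) ⟧) ≡ ∑ D (λ d → ⟦ ¬? (2 ∣? d) ⟧)
  odd = ∑-⟦⟧-bijection (λ d → ¬? (2 ∣? d)) (λ d → ¬? (2 ∣? d)) (divisors-unique (k + k)) (divisors-unique k) id id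
    (λ {d} d∈ 2∤d → ∈-divisors⁺ (coprime-divisor (odd⇒Coprime-2 2∤d) (subst (d ∣_) (*-comm k 2) (∣k*2 d∈))) , 2∤d , refl)
    (λ d∈ 2∤d → ∈D₂ (∣m⇒∣m*n 2 (∣k d∈)) , 2∤d , refl)

-- Inversions under conjugation

invF≡∑ : (f : Fin n → Fin n) →
         invF f ≡ ∑ (allFin n) (λ i → ∑ (allFin n) (λ j → ⟦ toℕ i <? toℕ j ⟧ * ⟦ toℕ (f j) <? toℕ (f i) ⟧))
invF≡∑ {n} f = begin
  invF f
    ≡⟨ length-filter (λ (i , j) → (toℕ i <? toℕ j) ×-dec (toℕ (f j) <? toℕ (f i))) (cartesianProduct (allFin n) (allFin n)) ⟩
  ∑ (cartesianProduct (allFin n) (allFin n)) (λ (i , j) → ⟦ (toℕ i <? toℕ j) ×-dec (toℕ (f j) <? toℕ (f i)) ⟧)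
    ≡⟨ ∑-cartesianProduct (allFin n) (allFin n) _ ⟩
  ∑ (allFin n) (λ i → ∑ (allFin n) (λ j → ⟦ (toℕ i <? toℕ j) ×-dec (toℕ (f j) <? toℕ (f i)) ⟧))
    ≡⟨ ∑-ext (allFin n) (λ i → ∑-ext (allFin n) (λ j → ⟦⟧-× (toℕ i <? toℕ j) (toℕ (f j) <? toℕ (f i)))) ⟩
  ∑ (allFin n) (λ i → ∑ (allFin n) (λ j → ⟦ toℕ i <? toℕ j ⟧ * ⟦ toℕ (f j) <? toℕ (f i) ⟧))  ∎

∑-allFin-permute : (g : Permutation′ n) (f : Fin n → ℕ) → ∑ (allFin n) f ≡ ∑ (allFin n) (λ x → f (g ⟨$⟩ʳ x))
∑-allFin-permute {n} g f = ∑-bijection (Unique.allFin⁺ n) (Unique.allFin⁺ n) (g ⟨$⟩ˡ_) (g ⟨$⟩ʳ_)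
  (λ _ → ∈-allFin _) (λ _ → ∈-allFin _) (λ _ → inverseʳ g) (λ _ → inverseˡ g) (λ _ → cong f (sym (inverseʳ g)))

invF-cong : {f h : Fin n → Fin n} → (∀ i → f i ≡ h i) → invF f ≡ invF h
invF-cong {n} {f} {h} f≗h = begin
  invF f  ≡⟨ invF≡∑ f ⟩
  _       ≡⟨ ∑-ext (allFin n) (λ i → ∑-ext (allFin n) (λ j →
               cong₂ (λ a b → ⟦ toℕ i <? toℕ j ⟧ * ⟦ toℕ a <? toℕ b ⟧) (f≗h j) (f≗h i))) ⟩
  _       ≡⟨ invF≡∑ h ⟨
  invF h  ∎

-- Substituting i = g x and j = g y removes the inverse of `g` from both comparisons.
invF-conjugate : (g : Permutation′ n) (f : Fin n → Fin n) →
  invF (λ i → g ⟨$⟩ʳ f (g ⟨$⟩ˡ i)) ≡ ∑ (allFin n) (λ x → ∑ (allFin n) (λ y → lt (g ⟨$⟩ʳ_) x y * lt (g ⟨$⟩ʳ_) (f y) (f x)))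
invF-conjugate {n} g f = begin
  invF (λ i → g ⟨$⟩ʳ f (g ⟨$⟩ˡ i))  ≡⟨ invF≡∑ (λ i → g ⟨$⟩ʳ f (g ⟨$⟩ˡ i)) ⟩
  ∑ (allFin n) (λ i → ∑ (allFin n) (λ j → ⟦ toℕ i <? toℕ j ⟧ * lt (g ⟨$⟩ʳ_) (f (g ⟨$⟩ˡ j)) (f (g ⟨$⟩ˡ i))))
    ≡⟨ trans (∑-allFin-permute g _) (∑-ext (allFin n) (λ x → ∑-allFin-permute g _)) ⟩
  ∑ (allFin n) (λ x → ∑ (allFin n) (λ y → lt (g ⟨$⟩ʳ_) x y * lt (g ⟨$⟩ʳ_) (f (g ⟨$⟩ˡ (g ⟨$⟩ʳ y))) (f (g ⟨$⟩ˡ (g ⟨$⟩ʳ x)))))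
    ≡⟨ ∑-ext (allFin n) (λ x → ∑-ext (allFin n) (λ y →
         cong₂ (λ a b → lt (g ⟨$⟩ʳ_) x y * lt (g ⟨$⟩ʳ_) (f a) (f b)) (inverseˡ g) (inverseˡ g))) ⟩
  ∑ (allFin n) (λ x → ∑ (allFin n) (λ y → lt (g ⟨$⟩ʳ_) x y * lt (g ⟨$⟩ʳ_) (f y) (f x)))  ∎

iter-cong : {A : Set} {f h : A → A} → (∀ x → f x ≡ h x) → ∀ k x → iter k f x ≡ iter k h x
iter-cong                 f≗h zero    x = refl
iter-cong {f = f} {h = h} f≗h (suc k) x = trans (f≗h (iter k f x)) (cong h (iter-cong f≗h k x))

iter-conjugate : (g : Permutation′ n) (f : Fin n → Fin n) → ∀ k i →
                 iter k (λ j → g ⟨$⟩ʳ f (g ⟨$⟩ˡ j)) i ≡ g ⟨$⟩ʳ iter k f (g ⟨$⟩ˡ i)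
iter-conjugate g f zero    i = sym (inverseʳ g)
iter-conjugate g f (suc k) i = cong (g ⟨$⟩ʳ_) (trans (cong (λ j → f (g ⟨$⟩ˡ j)) (iter-conjugate g f k i)) (cong f (inverseˡ g)))

iter-injective : {A : Set} {f : A → A} → Injective _≡_ _≡_ f → ∀ k → Injective _≡_ _≡_ (iter k f)
iter-injective inj zero    eq = eq
iter-injective inj (suc k) eq = iter-injective inj k (inj eq)

-- Conjugation by `w` is a bijection of the symmetric group and commutes with taking powers. The
-- left side does not mention `w`, so the identity can be summed over all `w`.
sumInvPow-conjugate : ∀ {n} k {w} → w ∈ perms n → sumInvPow n k ≡
  ∑ (perms n) (λ v → ∑ (allFin n) (λ x → ∑ (allFin n) (λ y →
    lt (lookup w) x y * lt (lookup w) (iter k (lookup v) y) (iter k (lookup v) x))))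
sumInvPow-conjugate {n} k {w} w∈ = begin
  ∑ (perms n) (λ v → invF (iter k (lookup v)))
    ≡⟨ ∑-perms-invariant {F = λ f → invF (iter k f)} (λ f≗h → invF-cong (iter-cong f≗h k)) g (flip g) ⟩
  ∑ (perms n) (λ v → invF (iter k (λ i → g ⟨$⟩ʳ lookup v (g ⟨$⟩ˡ i))))
    ≡⟨ ∑-ext (perms n) (λ v → trans (invF-cong (iter-conjugate g (lookup v) k)) (invF-conjugate g (iter k (lookup v)))) ⟩
  ∑ (perms n) (λ v → ∑ (allFin n) (λ x → ∑ (allFin n) (λ y →
    lt (g ⟨$⟩ʳ_) x y * lt (g ⟨$⟩ʳ_) (iter k (lookup v) y) (iter k (lookup v) x))))
    ≡⟨ ∑-ext (perms n) (λ v → ∑-ext (allFin n) (λ x → ∑-ext (allFin n) (λ y →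
         cong₂ _*_ (lt-g x y) (lt-g (iter k (lookup v) y) (iter k (lookup v) x))))) ⟩
  ∑ (perms n) (λ v → ∑ (allFin n) (λ x → ∑ (allFin n) (λ y →
    lt (lookup w) x y * lt (lookup w) (iter k (lookup v) y) (iter k (lookup v) x))))  ∎
  where
  g = Injective⇒Permutation (lookup w) (perms-injective w∈)
  g≗w = Injective⇒Permutation-≗ (lookup w) (perms-injective w∈)
  lt-g : ∀ x y → lt (g ⟨$⟩ʳ_) x y ≡ lt (lookup w) x y
  lt-g x y = cong₂ (λ a b → ⟦ toℕ a <? toℕ b ⟧) (g≗w x) (g≗w y)

-- The sum of the inversion numbers of all conjugates of `f`, that is, n! times their mean, with the
-- sum over the conjugating permutation moved inside.
#inverted : (Fin n → Fin n) → ℕ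
#inverted {n} f = ∑ (allFin n) (λ x → ∑ (allFin n) (λ y → #<< x y (f y) (f x)))

sumInvPow-average : ∀ n k → n ! * sumInvPow n k ≡ ∑ (perms n) (λ v → #inverted (iter k (lookup v)))
sumInvPow-average n k = begin
  n ! * sumInvPow n k
    ≡⟨ cong (_* sumInvPow n k) (length-perms n) ⟨
  length (perms n) * sumInvPow n k
    ≡⟨ ∑-const (perms n) (sumInvPow n k) ⟨
  ∑ (perms n) (λ w → sumInvPow n k)
    ≡⟨ ∑-cong (perms n) (sumInvPow-conjugate k) ⟩
  ∑ (perms n) (λ w → ∑ (perms n) (λ v → ∑ (allFin n) (λ x → ∑ (allFin n) (λ y → inverted w (iter k (lookup v)) x y))))
    ≡⟨ ∑-swap (perms n) (perms n) _ ⟩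
  ∑ (perms n) (λ v → ∑ (perms n) (λ w → ∑ (allFin n) (λ x → ∑ (allFin n) (λ y → inverted w (iter k (lookup v)) x y))))
    ≡⟨ ∑-ext (perms n) (λ v → trans (∑-swap (perms n) (allFin n) _)
                                     (∑-ext (allFin n) (λ x → ∑-swap (perms n) (allFin n) _))) ⟩
  ∑ (perms n) (λ v → #inverted (iter k (lookup v)))  ∎
  where
  inverted : Vec (Fin n) n → (Fin n → Fin n) → Fin n → Fin n → ℕ
  inverted w f x y = lt (lookup w) x y * lt (lookup w) (f y) (f x)

-- Summing the pattern identity over all pairs of points

∑-allFin-const : ∀ n c → ∑ (allFin n) (λ _ → c) ≡ n * c
∑-allFin-const n c = trans (∑-const (allFin n) c) (cong (_* c) (length-allFin n))

∑-⟦≟⟧ : (x : Fin n) → ∑ (allFin n) (λ y → ⟦ x ≟ y ⟧) ≡ 1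
∑-⟦≟⟧ {n} x = trans
  (∑-ext (allFin n) (λ y → trans (⟦⟧-cong (x ≟ y) (y ≟ x) sym sym) (sym (*-identityʳ ⟦ y ≟ x ⟧))))
  (∑-δ x (λ _ → 1))

module _ (f : Fin n → Fin n) (f-injective : Injective _≡_ _≡_ f) where

  private
    V = allFin n
    N = n !
    F F² : ℕ
    F = ∑ V (λ x → ⟦ f x ≟ x ⟧)
    F² = ∑ V (λ x → ⟦ f (f x) ≟ x ⟧)

  ∑∑-fixed : ∑ V (λ x → ∑ V (λ y → ⟦ f x ≟ x ⟧ + ⟦ f y ≟ y ⟧ + ⟦ f x ≟ x ⟧ * ⟦ f y ≟ y ⟧ + 3 * ⟦ x ≟ y ⟧))
             ≡ 2 * n * F + F * F + 3 * n
  ∑∑-fixed = begin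
    ∑ V (λ x → ∑ V (λ y → δ x + δ y + δ x * δ y + 3 * ⟦ x ≟ y ⟧))
      ≡⟨ ∑-ext V inner ⟩
    ∑ V (λ x → δ x * n + F + δ x * F + 3)
      ≡⟨ trans (∑-+ V _ _) (cong₂ _+_ (trans (∑-+ V _ _) (cong₂ _+_ (trans (∑-+ V _ _)
           (cong₂ _+_ (∑-*ʳ V n δ) (∑-allFin-const n F))) (∑-*ʳ V F δ))) (∑-allFin-const n 3)) ⟩
    F * n + n * F + F * F + n * 3
      ≡⟨ collect n F ⟩
    2 * n * F + F * F + 3 * n  ∎
    where
    δ : Fin n → ℕ
    δ x = ⟦ f x ≟ x ⟧
    collect : ∀ n F → F * n + n * F + F * F + n * 3 ≡ 2 * n * F + F * F + 3 * n
    collect = solve-∀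
    inner : ∀ x → ∑ V (λ y → δ x + δ y + δ x * δ y + 3 * ⟦ x ≟ y ⟧) ≡ δ x * n + F + δ x * F + 3
    inner x = trans (∑-+ V _ _) (cong₂ _+_
      (trans (∑-+ V _ _) (cong₂ _+_
        (trans (∑-+ V _ _) (cong (_+ F) (trans (∑-allFin-const n (δ x)) (*-comm n (δ x)))))
        (∑-*ˡ V (δ x) δ)))
      (trans (∑-*ˡ V 3 _) (cong (3 *_) (∑-⟦≟⟧ x))))

  -- Each of the two single indicators sums to `n`. Their product is nonzero only for y = f x with f
  -- (f x) = x, which is how the fixed points of the square arise.
  ∑∑-moved : ∑ V (λ x → ∑ V (λ y → 3 + ⟦ f x ≟ y ⟧ + ⟦ f y ≟ x ⟧ + ⟦ f x ≟ y ⟧ * ⟦ f y ≟ x ⟧))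
             ≡ 3 * n * n + 2 * n + F²
  ∑∑-moved = begin
    ∑ V (λ x → ∑ V (λ y → 3 + ⟦ f x ≟ y ⟧ + ⟦ f y ≟ x ⟧ + ⟦ f x ≟ y ⟧ * ⟦ f y ≟ x ⟧))
      ≡⟨ ∑-ext V inner ⟩
    ∑ V (λ x → n * 3 + 1 + ∑ V (λ y → ⟦ f y ≟ x ⟧) + ⟦ f (f x) ≟ x ⟧)
      ≡⟨ trans (∑-+ V _ _) (cong (_+ F²) (trans (∑-+ V _ _) (cong₂ _+_ (∑-allFin-const n (n * 3 + 1))
           (trans (∑-swap V V _) (trans (∑-ext V (λ y → ∑-⟦≟⟧ (f y))) (∑-allFin-const n 1)))))) ⟩
    n * (n * 3 + 1) + n * 1 + F²
      ≡⟨ collect n F² ⟩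
    3 * n * n + 2 * n + F²  ∎
    where
    collect : ∀ n F → n * (n * 3 + 1) + n * 1 + F ≡ 3 * n * n + 2 * n + F
    collect = solve-∀
    inner : ∀ x → ∑ V (λ y → 3 + ⟦ f x ≟ y ⟧ + ⟦ f y ≟ x ⟧ + ⟦ f x ≟ y ⟧ * ⟦ f y ≟ x ⟧)
                  ≡ n * 3 + 1 + ∑ V (λ y → ⟦ f y ≟ x ⟧) + ⟦ f (f x) ≟ x ⟧
    inner x = trans (∑-+ V _ _) (cong₂ _+_
      (trans (∑-+ V _ _) (cong (_+ ∑ V (λ y → ⟦ f y ≟ x ⟧))
        (trans (∑-+ V _ _) (cong₂ _+_ (∑-allFin-const n 3) (∑-⟦≟⟧ (f x))))))
      (trans (∑-ext V (λ y → cong (_* ⟦ f y ≟ x ⟧) (⟦⟧-cong (f x ≟ y) (y ≟ f x) sym sym)))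
             (∑-δ (f x) (λ y → ⟦ f y ≟ x ⟧))))

  12#inverted : 12 * #inverted f + N * (2 * n * F + F * F + 3 * n) ≡ N * (3 * n * n + 2 * n + F²)
  12#inverted = begin
    12 * #inverted f + N * (2 * n * F + F * F + 3 * n)
      ≡⟨ cong₂ _+_ (∑∑-* 12 (λ x y → #<< x y (f y) (f x))) (trans (∑∑-* N _) (cong (N *_) ∑∑-fixed)) ⟨
    ∑ V (λ x → ∑ V (λ y → 12 * #<< x y (f y) (f x)))
      + ∑ V (λ x → ∑ V (λ y → N * (⟦ f x ≟ x ⟧ + ⟦ f y ≟ y ⟧ + ⟦ f x ≟ x ⟧ * ⟦ f y ≟ y ⟧ + 3 * ⟦ x ≟ y ⟧)))
      ≡⟨ trans (∑-ext V (λ x → ∑-+ V _ _)) (∑-+ V _ _) ⟨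
    ∑ V (λ x → ∑ V (λ y → 12 * #<< x y (f y) (f x)
                          + N * (⟦ f x ≟ x ⟧ + ⟦ f y ≟ y ⟧ + ⟦ f x ≟ x ⟧ * ⟦ f y ≟ y ⟧ + 3 * ⟦ x ≟ y ⟧)))
      ≡⟨ ∑-ext V (λ x → ∑-ext V (λ y → 12#<< x y (f x) (f y) (cong f) f-injective)) ⟩
    ∑ V (λ x → ∑ V (λ y → N * (3 + ⟦ f x ≟ y ⟧ + ⟦ f y ≟ x ⟧ + ⟦ f x ≟ y ⟧ * ⟦ f y ≟ x ⟧)))
      ≡⟨ trans (∑∑-* N _) (cong (N *_) ∑∑-moved) ⟩
    N * (3 * n * n + 2 * n + F²)  ∎
    where
    ∑∑-* : ∀ c (g : Fin n → Fin n → ℕ) → ∑ V (λ x → ∑ V (λ y → c * g x y)) ≡ c * ∑ V (λ x → ∑ V (g x))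
    ∑∑-* c g = trans (∑-ext V (λ x → ∑-*ˡ V c (g x))) (∑-*ˡ V c _)

12sumInvPow : ∀ k n .{{_ : NonZero k}} → k + k ≤ n →
  12 * sumInvPow n k + n ! * (2 * n * τ k + (σ k + τ k * τ k) + 3 * n) ≡ n ! * (3 * n * n + 2 * n + (τ k + τₒ k))
-- The cancelled factor `N` is the number of conjugating permutations brought in by
-- `sumInvPow-average`.
12sumInvPow k n 2k≤n = *-cancelˡ-≡ _ _ N {{n !≢0}} (begin
  N * (12 * sumInvPow n k + N * (2 * n * τ k + (σ k + τ k * τ k) + 3 * n))
    ≡⟨ expand N (sumInvPow n k) n (τ k) (σ k) ⟩
  12 * (N * sumInvPow n k) + N * (2 * n * (τ k * N) + (N * σ k + τ k * (τ k * N)) + N * (3 * n))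
    ≡⟨ cong₂ _+_ (trans (∑-*ˡ Sₙ 12 _) (cong (12 *_) (sym (sumInvPow-average n k))))
         (trans (∑-*ˡ Sₙ N _) (cong (N *_) (trans (∑-+ Sₙ _ _) (cong₂ _+_
           (trans (∑-+ Sₙ _ _) (cong₂ _+_ (trans (∑-*ˡ Sₙ (2 * n) _) (cong (2 * n *_) (∑-#fixed k k≤n))) (∑-#fixed² k 2k≤n)))
           (∑-perms-const (3 * n)))))) ⟨
  ∑ Sₙ (λ v → 12 * #inverted (iter k (lookup v))) + ∑ Sₙ (λ v → N * (2 * n * F v + F v * F v + 3 * n))
    ≡⟨ ∑-+ Sₙ _ _ ⟨
  ∑ Sₙ (λ v → 12 * #inverted (iter k (lookup v)) + N * (2 * n * F v + F v * F v + 3 * n))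
    ≡⟨ ∑-cong Sₙ (λ {v} v∈ → trans
         (12#inverted (iter k (lookup v)) (iter-injective (perms-injective v∈) k))
         (cong (λ a → N * (3 * n * n + 2 * n + a)) (#fixed-double (lookup v) k))) ⟩
  ∑ Sₙ (λ v → N * (3 * n * n + 2 * n + #fixed (lookup v) (k + k)))
    ≡⟨ trans (∑-*ˡ Sₙ N _) (cong (N *_) (trans (∑-+ Sₙ _ _)
         (cong₂ _+_ (∑-perms-const (3 * n * n + 2 * n)) (trans (∑-#fixed (k + k) {{k+k≢0}} 2k≤n) (cong (_* N) (τ-double k)))))) ⟩
  N * (N * (3 * n * n + 2 * n) + (τ k + τₒ k) * N)
    ≡⟨ cong (N *_) (factor N (3 * n * n + 2 * n) (τ k + τₒ k)) ⟩
  N * (N * (3 * n * n + 2 * n + (τ k + τₒ k)))  ∎)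
  where
  N = n !
  Sₙ = perms n
  F : Vec (Fin n) n → ℕ
  F v = #fixed (lookup v) k
  k≤n = ≤-trans (m≤m+n k k) 2k≤n
  k+k≢0 : NonZero (k + k)
  k+k≢0 = >-nonZero (≤-trans (>-nonZero⁻¹ k) (m≤m+n k k))
  ∑-perms-const : ∀ c → ∑ Sₙ (λ _ → c) ≡ N * c
  ∑-perms-const c = trans (∑-const Sₙ c) (cong (_* c) (length-perms n))
  expand : ∀ N X n t s → N * (12 * X + N * (2 * n * t + (s + t * t) + 3 * n))
                         ≡ 12 * (N * X) + N * (2 * n * (t * N) + (N * s + t * (t * N)) + N * (3 * n))
  expand = solve-∀
  factor : ∀ N a b → N * a + b * N ≡ N * (a + b)
  factor = solve-∀

-- Rational form

import Data.Integer as ℤ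
open import Data.Integer using (ℤ; +_)
import Data.Integer.Properties as ℤ
import Data.Integer.Tactic.RingSolver as ℤSolver
import Data.Rational as ℚ
open import Data.Rational using (ℚ; _/_; _-_; toℚᵘ)
open import Data.Rational.Properties using (toℚᵘ-injective; toℚᵘ-fromℚᵘ; toℚᵘ-homo-+; toℚᵘ-homo‿-)
import Data.Rational.Unnormalised as ℚᵘ
import Data.Rational.Unnormalised.Properties as ℚᵘ

toℚᵘ-homo-- : ∀ p q → toℚᵘ (p - q) ℚᵘ.≃ toℚᵘ p ℚᵘ.- toℚᵘ q
toℚᵘ-homo-- p q = ℚᵘ.≃-trans (toℚᵘ-homo-+ p (ℚ.- q)) (ℚᵘ.+-congʳ (toℚᵘ p) (toℚᵘ-homo‿- q))

-- Unnormalised fractions compute on numerators and denominators without reduction, so the claim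
-- becomes an integer identity by cross-multiplication.
quotient-from-integers : ∀ X a b c N .{{_ : NonZero N}} →
  + 12 ℤ.* X ℤ.+ + N ℤ.* (+ 2 ℤ.* b ℤ.+ c) ≡ + N ℤ.* (+ 3 ℤ.* a) → X / N ≡ a / 4 - b / 6 - c / 12
quotient-from-integers X a b c (suc N) eq = toℚᵘ-injective (
  ℚᵘ.≃-trans (toℚᵘ-fromℚᵘ (ℚᵘ.mkℚᵘ X N)) (ℚᵘ.≃-trans (ℚᵘ.*≡* cross) (ℚᵘ.≃-sym
  (ℚᵘ.≃-trans (toℚᵘ-homo-- (a / 4 - b / 6) (c / 12))
  (ℚᵘ.≃-trans (ℚᵘ.+-congˡ (ℚᵘ.- toℚᵘ (c / 12)) (toℚᵘ-homo-- (a / 4) (b / 6)))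
  (ℚᵘ.+-cong (ℚᵘ.+-cong (toℚᵘ-fromℚᵘ (ℚᵘ.mkℚᵘ a 3)) (ℚᵘ.-‿cong (toℚᵘ-fromℚᵘ (ℚᵘ.mkℚᵘ b 5))))
             (ℚᵘ.-‿cong (toℚᵘ-fromℚᵘ (ℚᵘ.mkℚᵘ c 11)))))))))
  where
  -- The unreduced common denominator is 288 = 4 · 6 · 12, and 24 = 288 / 12 is the factor by which
  -- the hypothesis is scaled.
  isolate : ∀ X a b c N → X ℤ.* + 288 ≡
    + 24 ℤ.* (+ 12 ℤ.* X ℤ.+ N ℤ.* (+ 2 ℤ.* b ℤ.+ c)) ℤ.- N ℤ.* (+ 48 ℤ.* b ℤ.+ + 24 ℤ.* c)
  isolate = ℤSolver.solve-∀
  collect : ∀ a b c N → + 24 ℤ.* (N ℤ.* (+ 3 ℤ.* a)) ℤ.- N ℤ.* (+ 48 ℤ.* b ℤ.+ + 24 ℤ.* c)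
    ≡ ((a ℤ.* + 6 ℤ.+ (ℤ.- b) ℤ.* + 4) ℤ.* + 12 ℤ.+ (ℤ.- c) ℤ.* + 24) ℤ.* N
  collect = ℤSolver.solve-∀
  cross : X ℤ.* + 288 ≡ ((a ℤ.* + 6 ℤ.+ (ℤ.- b) ℤ.* + 4) ℤ.* + 12 ℤ.+ (ℤ.- c) ℤ.* + 24) ℤ.* + suc N
  cross = trans (isolate X a b c (+ suc N))
    (trans (cong (λ m → + 24 ℤ.* m ℤ.- + suc N ℤ.* (+ 48 ℤ.* b ℤ.+ + 24 ℤ.* c)) eq) (collect a b c (+ suc N)))

length≢0 : {A : Set} {x : A} {xs : Data.List.List A} → x ∈ xs → NonZero (length xs)
length≢0 (here _)  = _
length≢0 (there _) = _

-- Matching on successors turns `n ∸ 1` and `t ∸ 1` into true predecessors. The two forms then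
-- differ by N (5n + t + o) on either side: 3n together with the 2n hidden in 2 (t - 1) n, and t +
-- o, the number of divisors of 2k.
integer-form : ∀ X N n t o s .{{_ : NonZero n}} .{{_ : NonZero t}} →
  12 * X + N * (2 * n * t + (s + t * t) + 3 * n) ≡ N * (3 * n * n + 2 * n + (t + o)) →
  + 12 ℤ.* + X ℤ.+ + N ℤ.* (+ 2 ℤ.* + ((t ∸ 1) * n) ℤ.+ (+ (t * t) ℤ.- + t ℤ.- + o ℤ.+ + s))
    ≡ + N ℤ.* (+ 3 ℤ.* + (n * (n ∸ 1)))
integer-form X N (suc n) (suc t) o s eq = begin
  + 12 ℤ.* + X ℤ.+ + N ℤ.* (+ 2 ℤ.* + (t * suc n) ℤ.+ (+ (suc t * suc t) ℤ.- + suc t ℤ.- + o ℤ.+ + s))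
    ≡⟨ cong₂ (λ a b → + 12 ℤ.* + X ℤ.+ + N ℤ.* (+ 2 ℤ.* a ℤ.+ (b ℤ.- + suc t ℤ.- + o ℤ.+ + s)))
         (ℤ.pos-* t (suc n)) (ℤ.pos-* (suc t) (suc t)) ⟩
  + 12 ℤ.* + X ℤ.+ + N ℤ.* (+ 2 ℤ.* (+ t ℤ.* n⁺) ℤ.+ (t⁺ ℤ.* t⁺ ℤ.- t⁺ ℤ.- + o ℤ.+ + s))
    ≡⟨ shiftˡ (+ X) (+ N) (+ n) (+ t) (+ o) (+ s) ⟩
  + 12 ℤ.* + X ℤ.+ + N ℤ.* (+ 2 ℤ.* n⁺ ℤ.* t⁺ ℤ.+ (+ s ℤ.+ t⁺ ℤ.* t⁺) ℤ.+ + 3 ℤ.* n⁺)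
    ℤ.- + N ℤ.* (+ 5 ℤ.* n⁺ ℤ.+ t⁺ ℤ.+ + o)
    ≡⟨ cong (ℤ._- + N ℤ.* (+ 5 ℤ.* n⁺ ℤ.+ t⁺ ℤ.+ + o)) lifted ⟩
  + N ℤ.* (+ 3 ℤ.* n⁺ ℤ.* n⁺ ℤ.+ + 2 ℤ.* n⁺ ℤ.+ (t⁺ ℤ.+ + o)) ℤ.- + N ℤ.* (+ 5 ℤ.* n⁺ ℤ.+ t⁺ ℤ.+ + o)
    ≡⟨ shiftʳ (+ N) (+ n) (+ t) (+ o) ⟩
  + N ℤ.* (+ 3 ℤ.* (n⁺ ℤ.* + n))
    ≡⟨ cong (λ a → + N ℤ.* (+ 3 ℤ.* a)) (ℤ.pos-* (suc n) n) ⟨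
  + N ℤ.* (+ 3 ℤ.* + (suc n * n))  ∎
  where
  n⁺ t⁺ : ℤ
  n⁺ = + 1 ℤ.+ + n
  t⁺ = + 1 ℤ.+ + t
  shiftˡ : ∀ X N n t o s →
    + 12 ℤ.* X ℤ.+ N ℤ.* (+ 2 ℤ.* (t ℤ.* (+ 1 ℤ.+ n)) ℤ.+ ((+ 1 ℤ.+ t) ℤ.* (+ 1 ℤ.+ t) ℤ.- (+ 1 ℤ.+ t) ℤ.- o ℤ.+ s))
    ≡ + 12 ℤ.* X ℤ.+ N ℤ.* (+ 2 ℤ.* (+ 1 ℤ.+ n) ℤ.* (+ 1 ℤ.+ t) ℤ.+ (s ℤ.+ (+ 1 ℤ.+ t) ℤ.* (+ 1 ℤ.+ t)) ℤ.+ + 3 ℤ.* (+ 1 ℤ.+ n))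
      ℤ.- N ℤ.* (+ 5 ℤ.* (+ 1 ℤ.+ n) ℤ.+ (+ 1 ℤ.+ t) ℤ.+ o)
  shiftˡ = ℤSolver.solve-∀
  shiftʳ : ∀ N n t o →
    N ℤ.* (+ 3 ℤ.* (+ 1 ℤ.+ n) ℤ.* (+ 1 ℤ.+ n) ℤ.+ + 2 ℤ.* (+ 1 ℤ.+ n) ℤ.+ ((+ 1 ℤ.+ t) ℤ.+ o))
      ℤ.- N ℤ.* (+ 5 ℤ.* (+ 1 ℤ.+ n) ℤ.+ (+ 1 ℤ.+ t) ℤ.+ o)
    ≡ N ℤ.* (+ 3 ℤ.* ((+ 1 ℤ.+ n) ℤ.* n))
  shiftʳ = ℤSolver.solve-∀
  pos-*-* : ∀ a b c → + (a * b * c) ≡ + a ℤ.* + b ℤ.* + c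
  pos-*-* a b c = trans (ℤ.pos-* (a * b) c) (cong (ℤ._* + c) (ℤ.pos-* a b))
  lifted : + 12 ℤ.* + X ℤ.+ + N ℤ.* (+ 2 ℤ.* n⁺ ℤ.* t⁺ ℤ.+ (+ s ℤ.+ t⁺ ℤ.* t⁺) ℤ.+ + 3 ℤ.* n⁺)
           ≡ + N ℤ.* (+ 3 ℤ.* n⁺ ℤ.* n⁺ ℤ.+ + 2 ℤ.* n⁺ ℤ.+ (t⁺ ℤ.+ + o))
  lifted = begin
    + 12 ℤ.* + X ℤ.+ + N ℤ.* (+ 2 ℤ.* n⁺ ℤ.* t⁺ ℤ.+ (+ s ℤ.+ t⁺ ℤ.* t⁺) ℤ.+ + 3 ℤ.* n⁺)
      ≡⟨ cong₂ ℤ._+_ (ℤ.pos-* 12 X) (trans (ℤ.pos-* N _) (cong (+ N ℤ.*_)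
           (cong₂ ℤ._+_ (cong₂ ℤ._+_ (pos-*-* 2 (suc n) (suc t)) (cong (λ a → + s ℤ.+ a) (ℤ.pos-* (suc t) (suc t)))) (ℤ.pos-* 3 (suc n))))) ⟨
    + (12 * X + N * (2 * suc n * suc t + (s + suc t * suc t) + 3 * suc n))
      ≡⟨ cong +_ eq ⟩
    + (N * (3 * suc n * suc n + 2 * suc n + (suc t + o)))
      ≡⟨ trans (ℤ.pos-* N _) (cong (+ N ℤ.*_) (cong (ℤ._+ (t⁺ ℤ.+ + o))
           (cong₂ ℤ._+_ (pos-*-* 3 (suc n) (suc n)) (ℤ.pos-* 2 (suc n))))) ⟩
    + N ℤ.* (+ 3 ℤ.* n⁺ ℤ.* n⁺ ℤ.+ + 2 ℤ.* n⁺ ℤ.+ (t⁺ ℤ.+ + o))  ∎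

theorem1p2 : (k n : ℕ) → .{{_ : NonZero k}} → n Data.Nat.≥ 2 Data.Nat.* k Data.Nat.+ 1 →
    avgInvPow n k
    ≡ ((+ (n Data.Nat.* (n Data.Nat.∸ 1))) / 4)
    - ((+ ((τ k Data.Nat.∸ 1) Data.Nat.* n)) / 6)
    - ((+ (τ k Data.Nat.* τ k) Data.Integer.- + τ k Data.Integer.- + τₒ k Data.Integer.+ + σ k) / 12)
theorem1p2 k n n≥2k+1 = quotient-from-integers (+ sumInvPow n k)
  (+ (n * (n ∸ 1))) (+ ((τ k ∸ 1) * n)) (+ (τ k * τ k) ℤ.- + τ k ℤ.- + τₒ k ℤ.+ + σ k) (n !) {{n !≢0}}
  -- Since `k` divides itself, `τ k` is positive and `τ k ∸ 1` is not truncated.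
  (integer-form (sumInvPow n k) (n !) n (τ k) (τₒ k) (σ k) {{n≢0}} {{length≢0 (∈-divisors⁺ {d = k} {k} ∣-refl)}}
    (12sumInvPow k n 2k≤n))
  where
  2k≤n : k + k ≤ n
  2k≤n = ≤-trans (≤-reflexive (cong (λ j → k + j) (sym (+-identityʳ k)))) (≤-trans (m≤m+n (2 * k) 1) n≥2k+1)
  n≢0 : NonZero n
  n≢0 = >-nonZero (≤-trans (m≤n+m 1 (2 * k)) n≥2k+1)
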